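{- Let $k\geq 2$ be an integer and let $0<p\leq 1/4$. Then there exist graphs with arbitrarily large numbers of vertices $n$ (more precisely, a sequence of graphs $G_m$ on $n_m$ vertices with $n_m\to\infty$) such that for every $j=2,\dots,k$ the number of labeled copies of $K_j$ in $G_m$ is $(1+o(1))p^{\binom{j}{2}}n_m^{j}$ as $m\to\infty$, and each $G_m$ contains an independent set of size at least $n_m/2$. Consequently, the family $\mathcal{K}_k=\{K_2,\dots,K_k\}$ is not forcing.
   Context: $K_j$ denotes the complete graph on $j$ vertices. A labeled copy of a graph $H$ in a graph $G$ is an injective map $V(H)\to V(G)$ sending edges of $H$ to edges of $G$. Asymptotic notation $o(1)$ refers to the number of vertices tending to infinity, all other parameters ($k$, $p$, $j$) being fixed. For $0<p<1$, a sequence of graphs $G$ on $n\to\infty$ vertices is called $p$-quasirandom if it has $(1+o(1))pn^2$ labeled edges and $(1+o(1))p^4n^4$ labeled copies of the $4$-cycle $C_4$; equivalently (Chung–Graham–Wilson), for every $c>0$ and every vertex set $S$ with $|S|\geq cn$, the number of labeled edges inside $S$ is $(1+o(1))p|S|^2$. A family of graphs $\mathcal{F}$ is forcing if for every $0<p<1$, every sequence of $n$-vertex graphs $G$ ($n\to\infty$) containing $(1+o(1))n^{|V(F)|}p^{|E(F)|}$ labeled copies of $F$ for every $F\in\mathcal{F}$ is $p$-quasirandom. -}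

module Defs where

open import Data.Bool using (Bool; true; false; not; _∧_)
open import Data.Nat as ℕ using (ℕ; zero; suc)
open import Data.Integer using (+_)
open import Data.Fin using (Fin; _≟_)
open import Data.Fin.Subset using (Subset; _∈_) renaming (∣_∣ to size)
open import Data.List using (List; []; _∷_; map; concatMap; filter; length; foldr)
open import Data.List.Base using (allFin)
open import Data.Vec using (Vec; lookup; tabulate)
open import Data.Rational using (ℚ; _+_; _*_; _-_; _≤_; _<_; ∣_∣; 0ℚ; 1ℚ; _/_)
open import Data.Product using (Σ; ∃; _×_; _,_)
open import Relation.Nullary using (¬_; does)
open import Relation.Binary.PropositionalEquality using (_≡_; _≢_)

-- Real numbers (Bishop-style regular Cauchy sequences of rationals)

inv : ℕ → ℚ
inv i = (+ 1) / suc i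

ℕtoℚ : ℕ → ℚ
ℕtoℚ n = (+ n) / 1

record ℝ : Set where
  field
    seq : ℕ → ℚ
    reg : ∀ i l → ∣ seq i - seq l ∣ ≤ inv i + inv l
open ℝ public

_<ʳ_ : ℚ → ℝ → Set
r <ʳ x = ∃ λ i → r + inv i < seq x i

_ʳ<_ : ℝ → ℚ → Set
x ʳ< r = ∃ λ i → seq x i + inv i < r

_ʳ≤_ : ℝ → ℚ → Set
x ʳ≤ r = ∀ i → seq x i - inv i ≤ r

_^ℚ_ : ℚ → ℕ → ℚ
q ^ℚ zero  = 1ℚ
q ^ℚ suc n = q * (q ^ℚ n)

choose2 : ℕ → ℕ
choose2 j = (j ℕ.* (j ℕ.∸ 1)) ℕ./ 2

record Graph (n : ℕ) : Set where
  field
    adj   : Fin n → Fin n → Bool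
    adj-sym : ∀ u v → adj u v ≡ adj v u
    adj-irrefl : ∀ u → adj u u ≡ false
open Graph public

K : (j : ℕ) → Graph j
K j = record { adj = λ a b → not (does (a ≟ b)) ; adj-sym = symK ; adj-irrefl = irrK }
  where
  open import Relation.Binary.PropositionalEquality using (refl; sym)
  open import Relation.Nullary using (yes; no)
  symK : ∀ a b → not (does (a ≟ b)) ≡ not (does (b ≟ a))
  symK a b with a ≟ b | b ≟ a
  ... | yes _ | yes _ = refl
  ... | no _  | no _  = refl
  ... | yes p | no q  = Data.Empty.⊥-elim (q (sym p)) where import Data.Empty
  ... | no p  | yes q = Data.Empty.⊥-elim (p (sym q)) where import Data.Empty
  irrK : ∀ a → not (does (a ≟ a)) ≡ false
  irrK a with a ≟ a
  ... | yes _ = refl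
  ... | no q  = Data.Empty.⊥-elim (q refl) where import Data.Empty

allMaps : (n j : ℕ) → List (Vec (Fin n) j)
allMaps n zero    = Vec.[] ∷ [] where import Data.Vec as Vec
allMaps n (suc j) = concatMap (λ v → map (λ x → x Vec.∷ v) (allFin n)) (allMaps n j)
  where import Data.Vec as Vec

allB : {A : Set} → (A → Bool) → List A → Bool
allB p = foldr (λ x b → p x ∧ b) true

isCopy : ∀ {h n} → Graph h → Graph n → Vec (Fin n) h → Bool
isCopy {h} H G f =
  allB (λ a → allB (λ b →
        (does (a ≟ b) ∨ not (does (lookup f a ≟ lookup f b)))
      ∧ (not (adj H a b) ∨ adj G (lookup f a) (lookup f b)))
      (allFin h)) (allFin h)
  where open import Data.Bool using (_∨_)

copies : ∀ {h n} → Graph h → Graph n → ℕ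
copies {h} {n} H G = length (filter (λ f → isCopy H G f ≟ᵇ true) (allMaps n h))
  where
  open import Data.Bool.Properties using () renaming (_≟_ to _≟ᵇ_)

Independent : ∀ {n} → Graph n → Subset n → Set
Independent G S = ∀ u v → u ∈ S → v ∈ S → adj G u v ≡ false

module Submission where

-- A complete multipartite graph on n vertices with parts of sizes a₁ n, …, aₖ n, where Σ aᵢ = 1,
-- has j! eⱼ(a) nʲ labelled copies of Kⱼ, so the aᵢ should be the roots of the polynomial
-- Σⱼ (-1)ʲ cⱼ uᵏ⁻ʲ with cⱼ = p^C(j,2) / j!.  Its successive coefficient ratios ρⱼ = cⱼ / cⱼ₋₁ = pʲ⁻¹ / j
-- satisfy 4 ρⱼ₊₁ < ρⱼ because p ≤ 1/4.  Hence at u = ρⱼ / 2 the j-th term dominates its neighbours,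
-- the polynomial alternates in sign at these points, and it has k positive roots, the largest of
-- which exceeds ρ₁ / 2 = 1/2: the corresponding part is the independent set.
--
-- Real roots are avoided.  The number p is replaced by rationals q ≤ p tending to it, and the roots
-- are split off one at a time, largest first: dividing by u - y for an approximate root y leaves a
-- small remainder, which is dropped, and the quotient still alternates at the remaining points.

open import Defs
open import Data.Empty using (⊥-elim)
open import Data.Product using (Σ; ∃; _×_; _,_; proj₁; proj₂)
open import Data.Sum using (_⊎_; inj₁; inj₂)
open import Data.Fin.Subset using (Subset) renaming (∣_∣ to size)
open import Data.Vec as Vec using (Vec; []; _∷_; head; lookup; _[_]≔_; replicate; zipWith)
open import Data.Vec.Relation.Unary.All using (All; []; _∷_)
open import Function using (_∘_; id)
open import Relation.Nullary using (Dec; yes; no; does)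
open import Relation.Binary.PropositionalEquality
open import Tactic.RingSolver using (solve-∀)

-- Clique counts and independent sets in complete multipartite graphs.

module CompleteMultipartite where

  open import Data.Bool using (Bool; true; false; not; _∧_; _∨_; if_then_else_)
  open import Data.Bool.Properties using () renaming (_≟_ to _≟ᵇ_)
  open import Data.Nat using (ℕ; zero; suc; _+_; _*_; _≤_; z≤n; s≤s; _!)
  open import Data.Nat.Properties using (+-assoc; +-identityʳ; *-distribˡ-+; *-zeroʳ; *-identityˡ)
  open import Data.Nat.Tactic.RingSolver using () renaming (solve-∀ to solveℕ)
  open import Data.Fin using (Fin; zero; suc; _≟_)
  open import Data.Fin.Subset using (_∈_)
  open import Data.List using (List; []; _∷_; _++_; map; concatMap; filter; length; foldr; tabulate; allFin)
  open import Data.List.Properties using (map-tabulate)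
  open import Data.Vec.Properties using (lookup-map; lookup∘update; lookup∘update′; lookup-replicate; []=⇒lookup)

  ind : Bool → ℕ
  ind b = if b then 1 else 0

  ind-∧ : ∀ a b → ind (a ∧ b) ≡ ind a * ind b
  ind-∧ true  b = sym (+-identityʳ (ind b))
  ind-∧ false b = refl

  ∧-true⁻ : ∀ {a b} → a ∧ b ≡ true → a ≡ true × b ≡ true
  ∧-true⁻ {true} {true} _ = refl , refl

  ∧-true⁺ : ∀ {a b} → a ≡ true → b ≡ true → a ∧ b ≡ true
  ∧-true⁺ refl refl = refl

  Bool-ext : ∀ {a b} → (a ≡ true → b ≡ true) → (b ≡ true → a ≡ true) → a ≡ b
  Bool-ext {true}  {b}     f g = sym (f refl)
  Bool-ext {false} {true}  f g = g refl
  Bool-ext {false} {false} f g = refl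

  sumOver : {A : Set} → (A → ℕ) → List A → ℕ
  sumOver f = foldr (λ x s → f x + s) 0

  module _ {A : Set} where

    sumOver-cong : {f g : A → ℕ} → (∀ x → f x ≡ g x) → ∀ xs → sumOver f xs ≡ sumOver g xs
    sumOver-cong f≗g []       = refl
    sumOver-cong f≗g (x ∷ xs) = cong₂ _+_ (f≗g x) (sumOver-cong f≗g xs)

    sumOver-++ : ∀ (f : A → ℕ) xs ys → sumOver f (xs ++ ys) ≡ sumOver f xs + sumOver f ys
    sumOver-++ f []       ys = refl
    sumOver-++ f (x ∷ xs) ys = trans (cong (f x +_) (sumOver-++ f xs ys)) (sym (+-assoc (f x) _ _))

    sumOver-zero : ∀ (xs : List A) → sumOver (λ _ → 0) xs ≡ 0
    sumOver-zero []       = refl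
    sumOver-zero (x ∷ xs) = sumOver-zero xs

    sumOver-+ : ∀ (f g : A → ℕ) xs → sumOver (λ x → f x + g x) xs ≡ sumOver f xs + sumOver g xs
    sumOver-+ f g []       = refl
    sumOver-+ f g (x ∷ xs) rewrite sumOver-+ f g xs = shuffle (f x) (g x) (sumOver f xs) (sumOver g xs)
      where
      shuffle : ∀ a b c d → (a + b) + (c + d) ≡ (a + c) + (b + d)
      shuffle = solveℕ

    sumOver-* : ∀ c (f : A → ℕ) xs → sumOver (λ x → c * f x) xs ≡ c * sumOver f xs
    sumOver-* c f []       = sym (*-zeroʳ c)
    sumOver-* c f (x ∷ xs) rewrite sumOver-* c f xs = sym (*-distribˡ-+ c (f x) _)

    sumOver-map : ∀ {B : Set} (f : A → ℕ) (h : B → A) xs → sumOver f (map h xs) ≡ sumOver (f ∘ h) xs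
    sumOver-map f h []       = refl
    sumOver-map f h (x ∷ xs) = cong (f (h x) +_) (sumOver-map f h xs)

    sumOver-concatMap : ∀ {B : Set} (f : A → ℕ) (h : B → List A) xs →
      sumOver f (concatMap h xs) ≡ sumOver (λ x → sumOver f (h x)) xs
    sumOver-concatMap f h []       = refl
    sumOver-concatMap f h (x ∷ xs) =
      trans (sumOver-++ f (h x) (concatMap h xs)) (cong (sumOver f (h x) +_) (sumOver-concatMap f h xs))

  sumOver-swap : {A B : Set} (f : A → B → ℕ) → ∀ xs ys →
    sumOver (λ x → sumOver (f x) ys) xs ≡ sumOver (λ y → sumOver (λ x → f x y) xs) ys
  sumOver-swap f []       ys = sym (sumOver-zero ys)
  sumOver-swap f (x ∷ xs) ys rewrite sumOver-swap f xs ys =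
    sym (sumOver-+ (f x) (λ y → sumOver (λ x → f x y) xs) ys)

  length-filter-true : {A : Set} (b : A → Bool) (xs : List A) →
    length (filter (λ x → b x ≟ᵇ true) xs) ≡ sumOver (ind ∘ b) xs
  length-filter-true b []       = refl
  length-filter-true b (x ∷ xs) with b x
  ... | true  = cong suc (length-filter-true b xs)
  ... | false = length-filter-true b xs

  allB-true⁻ : ∀ {n} (q : Fin n → Bool) {m} (f : Fin m → Fin n) →
    allB q (tabulate f) ≡ true → ∀ i → q (f i) ≡ true
  allB-true⁻ q f eq zero    = proj₁ (∧-true⁻ eq)
  allB-true⁻ q f eq (suc i) = allB-true⁻ q (f ∘ suc) (proj₂ (∧-true⁻ eq)) i

  allB-true⁺ : ∀ {n} (q : Fin n → Bool) {m} (f : Fin m → Fin n) →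
    (∀ i → q (f i) ≡ true) → allB q (tabulate f) ≡ true
  allB-true⁺ q {zero}  f h = refl
  allB-true⁺ q {suc m} f h = ∧-true⁺ (h zero) (allB-true⁺ q (f ∘ suc) (h ∘ suc))

  -- Copies of a complete graph as tuples with pairwise distinct colours.

  multipartite : ∀ {n k} → Vec (Fin k) n → Graph n
  multipartite {k = k} col = record
    { adj        = λ u v → adj (K k) (lookup col u) (lookup col v)
    ; adj-sym    = λ u v → adj-sym (K k) (lookup col u) (lookup col v)
    ; adj-irrefl = λ u → adj-irrefl (K k) (lookup col u)
    }

  K-adj⁺ : ∀ {k} {a b : Fin k} → a ≢ b → adj (K k) a b ≡ true
  K-adj⁺ {a = a} {b} a≢b with a ≟ b
  ... | yes a≡b = ⊥-elim (a≢b a≡b)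
  ... | no  _   = refl

  K-adj⁻ : ∀ {k} {a b : Fin k} → adj (K k) a b ≡ true → a ≢ b
  K-adj⁻ {a = a} adj≡true refl with () ← trans (sym adj≡true) (adj-irrefl (K _) a)

  -- The mask `χ` is the palette of colours still available, and each entry removes its own colour
  -- from it. Distinctness thus becomes a recursion that peels off one vertex at a time, as
  -- `allMaps` does.
  rainbow : ∀ {k j} → Vec Bool k → Vec (Fin k) j → Bool
  rainbow χ []      = true
  rainbow χ (c ∷ v) = lookup χ c ∧ rainbow (χ [ c ]≔ false) v

  Distinct : ∀ {k j} → Vec (Fin k) j → Set
  Distinct v = ∀ a b → a ≢ b → lookup v a ≢ lookup v b

  rainbow⁻ : ∀ {k j} (χ : Vec Bool k) (v : Vec (Fin k) j) → rainbow χ v ≡ true →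
    (∀ a → lookup χ (lookup v a) ≡ true) × Distinct v
  rainbow⁻ χ []      _  = (λ ()) , λ ()
  rainbow⁻ {k} {suc j} χ (c ∷ v) eq = allowed , distinct
    where
    rec = rainbow⁻ (χ [ c ]≔ false) v (proj₂ (∧-true⁻ eq))
    ≢c : ∀ a → lookup v a ≢ c
    ≢c a refl with () ← trans (sym (proj₁ rec a)) (lookup∘update c χ false)
    allowed : ∀ a → lookup χ (lookup (c ∷ v) a) ≡ true
    allowed zero    = proj₁ (∧-true⁻ eq)
    allowed (suc a) = trans (sym (lookup∘update′ (≢c a) χ false)) (proj₁ rec a)
    distinct : Distinct (c ∷ v)
    distinct zero    zero    a≢b = ⊥-elim (a≢b refl)
    distinct zero    (suc b) a≢b = ≢c b ∘ sym
    distinct (suc a) zero    a≢b = ≢c a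
    distinct (suc a) (suc b) a≢b = proj₂ rec a b (a≢b ∘ cong suc)

  rainbow⁺ : ∀ {k j} (χ : Vec Bool k) (v : Vec (Fin k) j) →
    (∀ a → lookup χ (lookup v a) ≡ true) → Distinct v → rainbow χ v ≡ true
  rainbow⁺ χ []      allowed distinct = refl
  rainbow⁺ χ (c ∷ v) allowed distinct = ∧-true⁺ (allowed zero)
    (rainbow⁺ (χ [ c ]≔ false) v
      (λ a → trans (lookup∘update′ (distinct (suc a) zero λ ()) χ false) (allowed (suc a)))
      (λ a b a≢b → distinct (suc a) (suc b) λ { refl → a≢b refl }))

  isCopy-multipartite⁻ : ∀ {n k j} (col : Vec (Fin k) n) (v : Vec (Fin n) j) →
    isCopy (K j) (multipartite col) v ≡ true → Distinct (Vec.map (lookup col) v)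
  isCopy-multipartite⁻ {j = j} col v eq a b a≢b
    rewrite lookup-map a (lookup col) v | lookup-map b (lookup col) v =
    K-adj⁻ (adjacent (proj₂ (∧-true⁻ (allB-true⁻ _ id (allB-true⁻ _ id eq a) b))))
    where
    adjacent : ∀ {x} → not (adj (K j) a b) ∨ x ≡ true → x ≡ true
    adjacent h rewrite K-adj⁺ a≢b = h

  isCopy-multipartite⁺ : ∀ {n k j} (col : Vec (Fin k) n) (v : Vec (Fin n) j) →
    Distinct (Vec.map (lookup col) v) → isCopy (K j) (multipartite col) v ≡ true
  isCopy-multipartite⁺ {k = k} col v distinct =
    allB-true⁺ _ id λ a → allB-true⁺ _ id λ b → entry a b
    where
    entry : ∀ a b → (does (a ≟ b) ∨ not (does (lookup v a ≟ lookup v b)))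
                  ∧ (not (not (does (a ≟ b))) ∨ adj (multipartite col) (lookup v a) (lookup v b)) ≡ true
    entry a b with a ≟ b
    ... | yes _  = refl
    -- The injectivity test is literally adjacency in a complete graph on the vertices, and distinct
    -- colours force distinct vertices, so both conjuncts come from `col≢`.
    ... | no a≢b = ∧-true⁺ (K-adj⁺ (col≢ ∘ cong (lookup col))) (K-adj⁺ col≢)
      where
      col≢ : lookup col (lookup v a) ≢ lookup col (lookup v b)
      col≢ e = distinct a b a≢b
        (trans (lookup-map a (lookup col) v) (trans e (sym (lookup-map b (lookup col) v))))

  isCopy-multipartite : ∀ {n k j} (col : Vec (Fin k) n) (v : Vec (Fin n) j) →
    isCopy (K j) (multipartite col) v ≡ rainbow (replicate k true) (Vec.map (lookup col) v)
  isCopy-multipartite {k = k} col v = Bool-ext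
    (λ h → rainbow⁺ _ (Vec.map (lookup col) v)
      (λ a → lookup-replicate (lookup (Vec.map (lookup col) v) a) true)
      (isCopy-multipartite⁻ col v h))
    (λ h → isCopy-multipartite⁺ col v (proj₂ (rainbow⁻ _ (Vec.map (lookup col) v) h)))

  -- Counting rainbow tuples by elementary symmetric polynomials.

  dot : ∀ {k} → Vec ℕ k → (Fin k → ℕ) → ℕ
  dot []      g = 0
  dot (a ∷ s) g = a * g zero + dot s (g ∘ suc)

  dot-cong : ∀ {k} (s : Vec ℕ k) {f g} → (∀ i → f i ≡ g i) → dot s f ≡ dot s g
  dot-cong []      f≗g = refl
  dot-cong (a ∷ s) f≗g = cong₂ _+_ (cong (a *_) (f≗g zero)) (dot-cong s (f≗g ∘ suc))

  dot-linear : ∀ {k} (s : Vec ℕ k) c f g → dot s (λ i → f i + c * g i) ≡ dot s f + c * dot s g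
  dot-linear []      c f g = sym (*-zeroʳ c)
  dot-linear (a ∷ s) c f g rewrite dot-linear s c (f ∘ suc) (g ∘ suc) =
    shuffle a c (f zero) (g zero) (dot s (f ∘ suc)) (dot s (g ∘ suc))
    where
    shuffle : ∀ a c x y z w → a * (x + c * y) + (z + c * w) ≡ a * x + z + c * (a * y + w)
    shuffle = solveℕ

  -- Forbidding a colour changes the count exactly as emptying its part would, so the palette can be
  -- absorbed into the vector of part sizes.
  masked : ∀ {k} → Vec Bool k → Vec ℕ k → Vec ℕ k
  masked = zipWith (λ b a → ind b * a)

  masked-update : ∀ {k} (χ : Vec Bool k) s i → masked (χ [ i ]≔ false) s ≡ masked χ s [ i ]≔ 0
  masked-update (b ∷ χ) (a ∷ s) zero    = refl
  masked-update (b ∷ χ) (a ∷ s) (suc i) = cong (_ ∷_) (masked-update χ s i)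

  masked-true : ∀ {k} (s : Vec ℕ k) → masked (replicate k true) s ≡ s
  masked-true []      = refl
  masked-true (a ∷ s) = cong₂ _∷_ (*-identityˡ a) (masked-true s)

  dot-masked : ∀ {k} (χ : Vec Bool k) s g → dot s (λ i → ind (lookup χ i) * g i) ≡ dot (masked χ s) g
  dot-masked []      []      g = refl
  dot-masked (b ∷ χ) (a ∷ s) g = cong₂ _+_ (shuffle a (ind b) (g zero)) (dot-masked χ s (g ∘ suc))
    where
    shuffle : ∀ a b x → a * (b * x) ≡ b * a * x
    shuffle = solveℕ

  -- The elementary symmetric polynomial of degree `j`, split according to whether the first
  -- variable occurs in the monomial.
  esym : ∀ {k} → Vec ℕ k → ℕ → ℕ
  esym s       zero    = 1
  esym []      (suc j) = 0
  esym (a ∷ s) (suc j) = esym s (suc j) + a * esym s j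

  -- A squarefree monomial of degree `j + 1` arises once for each of its `j + 1` variables, taken as
  -- the factor `w i` in front of a monomial that avoids `i`.
  dot-esym : ∀ {k} (w : Vec ℕ k) j → dot w (λ i → esym (w [ i ]≔ 0) j) ≡ suc j * esym w (suc j)
  dot-esym []      j    = sym (*-zeroʳ (suc j))
  dot-esym (a ∷ s) zero rewrite dot-esym s zero = shuffle a (esym s 1)
    where
    shuffle : ∀ a x → a * 1 + (x + 0) ≡ x + a * 1 + 0
    shuffle = solveℕ
  dot-esym (a ∷ s) (suc j)
    rewrite dot-linear s a (λ i → esym (s [ i ]≔ 0) (suc j)) (λ i → esym (s [ i ]≔ 0) j)
          | dot-esym s (suc j) | dot-esym s j =
    shuffle j a (esym s (suc j)) (esym s (suc (suc j)))
    where
    shuffle : ∀ j a x y →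
      a * (x + 0) + (suc (suc j) * y + a * (suc j * x)) ≡ suc (suc j) * (y + a * x)
    shuffle = solveℕ

  -- Induction on `j`: fix the colour `c` of the first vertex, count the remaining tuples with `c`
  -- removed from the palette, and sum over `c` by `dot-esym`. The hypothesis on `col` says that `s`
  -- lists the colour class sizes, which turns sums over vertices into sums over colours.
  rainbow-count : ∀ {n k} (col : Vec (Fin k) n) (s : Vec ℕ k) →
    (∀ g → sumOver (g ∘ lookup col) (allFin n) ≡ dot s g) → ∀ j χ →
    sumOver (λ v → ind (rainbow χ (Vec.map (lookup col) v))) (allMaps n j) ≡ j ! * esym (masked χ s) j
  rainbow-count col s hist zero    χ = refl
  rainbow-count {n} col s hist (suc j) χ = begin
    sumOver F (concatMap (λ v → map (_∷ v) (allFin n)) (allMaps n j))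
      ≡⟨ sumOver-concatMap F _ (allMaps n j) ⟩
    sumOver (λ v → sumOver F (map (_∷ v) (allFin n))) (allMaps n j)
      ≡⟨ sumOver-cong (λ v → trans (sumOver-map F (_∷ v) (allFin n))
                                   (sumOver-cong (λ x → ind-∧ (lookup χ (lookup col x)) _) (allFin n)))
                      (allMaps n j) ⟩
    sumOver (λ v → sumOver (λ x → ind (lookup χ (lookup col x)) * R (lookup col x) v) (allFin n)) (allMaps n j)
      ≡⟨ sumOver-swap _ (allMaps n j) (allFin n) ⟩
    sumOver (λ x → sumOver (λ v → ind (lookup χ (lookup col x)) * R (lookup col x) v) (allMaps n j)) (allFin n)
      ≡⟨ sumOver-cong (λ x → sumOver-* (ind (lookup χ (lookup col x))) (R (lookup col x)) (allMaps n j)) (allFin n) ⟩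
    sumOver ((λ c → ind (lookup χ c) * sumOver (R c) (allMaps n j)) ∘ lookup col) (allFin n)
      ≡⟨ hist (λ c → ind (lookup χ c) * sumOver (R c) (allMaps n j)) ⟩
    dot s (λ c → ind (lookup χ c) * sumOver (R c) (allMaps n j))
      ≡⟨ dot-masked χ s (λ c → sumOver (R c) (allMaps n j)) ⟩
    dot w (λ c → sumOver (R c) (allMaps n j))
      ≡⟨ dot-cong w (λ c → trans (rainbow-count col s hist j (χ [ c ]≔ false))
                                 (cong (λ t → j ! * esym t j) (masked-update χ s c))) ⟩
    dot w (λ c → j ! * esym (w [ c ]≔ 0) j)
      -- Linearity with zero as the first function pulls out the factor `j !`.
      ≡⟨ dot-linear w (j !) (λ _ → 0) (λ c → esym (w [ c ]≔ 0) j) ⟩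
    dot w (λ _ → 0) + j ! * dot w (λ c → esym (w [ c ]≔ 0) j)
      ≡⟨ cong₂ (λ x y → x + j ! * y) (dot-zero w) (dot-esym w j) ⟩
    j ! * (suc j * esym w (suc j))
      ≡⟨ shuffle (j !) (suc j) (esym w (suc j)) ⟩
    suc j ! * esym w (suc j) ∎
    where
    open ≡-Reasoning
    w = masked χ s
    F : Vec (Fin n) (suc j) → ℕ
    F v = ind (rainbow χ (Vec.map (lookup col) v))
    R : Fin _ → Vec (Fin n) j → ℕ
    R c v = ind (rainbow (χ [ c ]≔ false) (Vec.map (lookup col) v))
    dot-zero : ∀ {k} (s : Vec ℕ k) → dot s (λ _ → 0) ≡ 0
    dot-zero []      = refl
    dot-zero (a ∷ s) = cong₂ _+_ (*-zeroʳ a) (dot-zero s)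
    shuffle : ∀ f m x → f * (m * x) ≡ m * f * x
    shuffle = solveℕ

  -- The graph with prescribed part sizes, and its first part.

  blocks : ∀ {k} (s : Vec ℕ k) → Vec (Fin k) (Vec.sum s)
  blocks []      = []
  blocks (a ∷ s) = replicate a zero Vec.++ Vec.map suc (blocks s)

  sumVec : ∀ {A : Set} {n} → (A → ℕ) → Vec A n → ℕ
  sumVec g []       = 0
  sumVec g (x ∷ xs) = g x + sumVec g xs

  sumOver-lookup : ∀ {A : Set} {n} (g : A → ℕ) (xs : Vec A n) → sumOver (g ∘ lookup xs) (allFin n) ≡ sumVec g xs
  sumOver-lookup g []       = refl
  sumOver-lookup {n = suc n} g (x ∷ xs) = cong (g x +_) (begin
    sumOver (g ∘ lookup (x ∷ xs)) (tabulate suc)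
      ≡⟨ cong (sumOver (g ∘ lookup (x ∷ xs))) (map-tabulate id suc) ⟨
    sumOver (g ∘ lookup (x ∷ xs)) (map suc (allFin n))
      ≡⟨ sumOver-map (g ∘ lookup (x ∷ xs)) suc (allFin n) ⟩
    sumOver (g ∘ lookup xs) (allFin n)
      ≡⟨ sumOver-lookup g xs ⟩
    sumVec g xs ∎)
    where open ≡-Reasoning

  sumVec-block : ∀ {A B : Set} {n} (g : A → ℕ) a (x : A) (h : B → A) (ys : Vec B n) →
    sumVec g (replicate a x Vec.++ Vec.map h ys) ≡ a * g x + sumVec (g ∘ h) ys
  sumVec-block g zero    x h []       = refl
  sumVec-block g zero    x h (y ∷ ys) = cong (g (h y) +_) (sumVec-block g zero x h ys)
  sumVec-block g (suc a) x h ys       =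
    trans (cong (g x +_) (sumVec-block g a x h ys)) (sym (+-assoc (g x) (a * g x) _))

  sumVec-blocks : ∀ {k} (s : Vec ℕ k) g → sumVec g (blocks s) ≡ dot s g
  sumVec-blocks []      g = refl
  sumVec-blocks (a ∷ s) g =
    trans (sumVec-block g a zero suc (blocks s)) (cong (a * g zero +_) (sumVec-blocks s (g ∘ suc)))

  multipartite-cliques : ∀ {k} (s : Vec ℕ k) j → copies (K j) (multipartite (blocks s)) ≡ j ! * esym s j
  multipartite-cliques {k} s j = begin
    copies (K j) (multipartite (blocks s))
      ≡⟨ length-filter-true _ (allMaps _ j) ⟩
    sumOver (ind ∘ isCopy (K j) (multipartite (blocks s))) (allMaps _ j)
      ≡⟨ sumOver-cong (λ v → cong ind (isCopy-multipartite (blocks s) v)) (allMaps _ j) ⟩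
    sumOver (λ v → ind (rainbow (replicate k true) (Vec.map (lookup (blocks s)) v))) (allMaps _ j)
      ≡⟨ rainbow-count (blocks s) s (λ g → trans (sumOver-lookup g (blocks s)) (sumVec-blocks s g))
                       j (replicate k true) ⟩
    j ! * esym (masked (replicate k true) s) j
      ≡⟨ cong (λ t → j ! * esym t j) (masked-true s) ⟩
    j ! * esym s j ∎
    where open ≡-Reasoning

  -- Selects the first part. The first root extracted later exceeds 1/2, so this part will hold at
  -- least half of the vertices.
  isZero : ∀ {k} → Fin k → Bool
  isZero zero    = true
  isZero (suc _) = false

  multipartite-independent : ∀ {n k} (col : Vec (Fin k) n) → Independent (multipartite col) (Vec.map isZero col)
  multipartite-independent col u v u∈S v∈S =
    sameColour (lookup col u) (lookup col v) (colour u u∈S) (colour v v∈S)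
    where
    colour : ∀ u → u ∈ Vec.map isZero col → isZero (lookup col u) ≡ true
    colour u u∈S = trans (sym (lookup-map u isZero col)) ([]=⇒lookup u∈S)
    sameColour : ∀ {k} (a b : Fin k) → isZero a ≡ true → isZero b ≡ true → adj (K k) a b ≡ false
    sameColour zero zero _ _ = refl

  firstBlock-size : ∀ {k} a (s : Vec ℕ k) → a ≤ size (Vec.map isZero (blocks (a ∷ s)))
  firstBlock-size a s = go a (Vec.map suc (blocks s))
    where
    go : ∀ {k n} a (xs : Vec (Fin (suc k)) n) → a ≤ size (Vec.map isZero (replicate a zero Vec.++ xs))
    go zero    xs = z≤n
    go (suc a) xs = s≤s (go a xs)

-- Inequalities, natural numbers, reciprocals and powers in the rationals.

module OrderedFieldℚ where

  open import Data.Nat as ℕ using (ℕ; zero; suc)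
  import Data.Nat.Properties as ℕ
  open import Data.Rational
  open import Data.Rational.Properties
  open import Data.Integer using (+_; -[1+_])
  import Data.Integer as ℤ
  import Data.Integer.Properties as ℤ
  import Data.Rational.Unnormalised as ℚᵘ
  import Data.Rational.Unnormalised.Properties as ℚᵘ
  open import Data.Maybe using (Maybe; just; nothing)
  open import Level using (0ℓ)
  import Tactic.RingSolver.Core.AlmostCommutativeRing as ACR

  ring : ACR.AlmostCommutativeRing 0ℓ 0ℓ
  ring = ACR.fromCommutativeRing +-*-commutativeRing zero?
    where
    zero? : ∀ x → Maybe (0ℚ ≡ x)
    zero? x with 0ℚ ≟ x
    ... | yes e = just e
    ... | no  _ = nothing

  2ℚ : ℚ
  2ℚ = 1ℚ + 1ℚ

  -- The pattern for most inequalities below: exhibit the difference as a visibly nonnegative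
  -- expression and leave the identity to the ring solver.
  ≤-by : ∀ {a b} d → 0ℚ ≤ d → b ≡ a + d → a ≤ b
  ≤-by {a} d 0≤d refl = subst (_≤ a + d) (+-identityʳ a) (+-monoʳ-≤ a 0≤d)

  <-by : ∀ {a b} d → 0ℚ < d → b ≡ a + d → a < b
  <-by {a} d 0<d refl = subst (_< a + d) (+-identityʳ a) (+-monoʳ-< a 0<d)

  p≤q⇒0≤q-p : ∀ {p q} → p ≤ q → 0ℚ ≤ q - p
  p≤q⇒0≤q-p {p} {q} p≤q = subst (_≤ q - p) (+-inverseʳ p) (+-monoˡ-≤ (- p) p≤q)

  p<q⇒0<q-p : ∀ {p q} → p < q → 0ℚ < q - p
  p<q⇒0<q-p {p} {q} p<q = subst (_< q - p) (+-inverseʳ p) (+-monoˡ-< (- p) p<q)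

  0≤+ : ∀ {p q} → 0ℚ ≤ p → 0ℚ ≤ q → 0ℚ ≤ p + q
  0≤+ = +-mono-≤

  0<+ : ∀ {p q} → 0ℚ < p → 0ℚ ≤ q → 0ℚ < p + q
  0<+ = +-mono-<-≤

  0≤* : ∀ {p q} → 0ℚ ≤ p → 0ℚ ≤ q → 0ℚ ≤ p * q
  0≤* {p} {q} 0≤p 0≤q =
    nonNegative⁻¹ _ {{nonNeg*nonNeg⇒nonNeg p {{nonNegative 0≤p}} q {{nonNegative 0≤q}}}}

  0<* : ∀ {p q} → 0ℚ < p → 0ℚ < q → 0ℚ < p * q
  0<* {p} {q} 0<p 0<q = positive⁻¹ _ {{pos*pos⇒pos p {{positive 0<p}} q {{positive 0<q}}}}

  0<*⁻ : ∀ {p q} → 0ℚ < p → 0ℚ < p * q → 0ℚ < q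
  0<*⁻ {p} {q} 0<p 0<pq =
    *-cancelˡ-<-nonNeg p {{nonNegative (<⇒≤ 0<p)}} (subst (_< p * q) (sym (*-zeroʳ p)) 0<pq)

  *-monoˡ : ∀ {r p q} → 0ℚ ≤ r → p ≤ q → r * p ≤ r * q
  *-monoˡ {r} 0≤r = *-monoˡ-≤-nonNeg r {{nonNegative 0≤r}}

  *-monoʳ : ∀ {r p q} → 0ℚ ≤ r → p ≤ q → p * r ≤ q * r
  *-monoʳ {r} 0≤r = *-monoʳ-≤-nonNeg r {{nonNegative 0≤r}}

  0<½ : 0ℚ < ½
  0<½ = positive⁻¹ ½

  0<1 : 0ℚ < 1ℚ
  0<1 = positive⁻¹ 1ℚ

  ∣p∣≤ : ∀ {p b} → p ≤ b → - p ≤ b → ∣ p ∣ ≤ b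
  ∣p∣≤ {p} p≤b -p≤b with ∣p∣≡p∨∣p∣≡-p p
  ... | inj₁ e = subst (_≤ _) (sym e) p≤b
  ... | inj₂ e = subst (_≤ _) (sym e) -p≤b

  p≤∣p∣ : ∀ p → p ≤ ∣ p ∣
  p≤∣p∣ p with ≤-total 0ℚ p
  ... | inj₁ 0≤p = ≤-reflexive (sym (0≤p⇒∣p∣≡p 0≤p))
  ... | inj₂ p≤0 = ≤-trans p≤0 (0≤∣p∣ p)

  -p≤∣p∣ : ∀ p → - p ≤ ∣ p ∣
  -p≤∣p∣ p = subst (- p ≤_) (∣-p∣≡∣p∣ p) (p≤∣p∣ (- p))

  -- Reduction to lowest terms blocks computation with symbolic fractions; the identities for `ℕtoℚ`
  -- and `inv` are therefore checked on unnormalised fractions, where they reduce to integer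
  -- arithmetic.
  toℚᵘ-/ : ∀ i d → toℚᵘ (i / suc d) ℚᵘ.≃ ℚᵘ.mkℚᵘ i d
  toℚᵘ-/ i d = toℚᵘ-fromℚᵘ (ℚᵘ.mkℚᵘ i d)

  ℕtoℚ-+ : ∀ m n → ℕtoℚ (m ℕ.+ n) ≡ ℕtoℚ m + ℕtoℚ n
  ℕtoℚ-+ m n = toℚᵘ-injective (begin
    toℚᵘ (ℕtoℚ (m ℕ.+ n))                     ≈⟨ toℚᵘ-/ (+ (m ℕ.+ n)) 0 ⟩
    ℚᵘ.mkℚᵘ (+ (m ℕ.+ n)) 0                  ≈⟨ ℚᵘ.*≡* (cong (ℤ._* + 1) sums) ⟩
    ℚᵘ.mkℚᵘ (+ m) 0 ℚᵘ.+ ℚᵘ.mkℚᵘ (+ n) 0    ≈⟨ ℚᵘ.+-cong (toℚᵘ-/ (+ m) 0) (toℚᵘ-/ (+ n) 0) ⟨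
    toℚᵘ (ℕtoℚ m) ℚᵘ.+ toℚᵘ (ℕtoℚ n)         ≈⟨ toℚᵘ-homo-+ (ℕtoℚ m) (ℕtoℚ n) ⟨
    toℚᵘ (ℕtoℚ m + ℕtoℚ n)                    ∎)
    where
    open ℚᵘ.≃-Reasoning
    sums : + (m ℕ.+ n) ≡ (+ m ℤ.* + 1) ℤ.+ (+ n ℤ.* + 1)
    sums = trans (ℤ.pos-+ m n) (sym (cong₂ ℤ._+_ (ℤ.*-identityʳ (+ m)) (ℤ.*-identityʳ (+ n))))

  ℕtoℚ-* : ∀ m n → ℕtoℚ (m ℕ.* n) ≡ ℕtoℚ m * ℕtoℚ n
  ℕtoℚ-* m n = toℚᵘ-injective (begin
    toℚᵘ (ℕtoℚ (m ℕ.* n))                     ≈⟨ toℚᵘ-/ (+ (m ℕ.* n)) 0 ⟩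
    ℚᵘ.mkℚᵘ (+ (m ℕ.* n)) 0                  ≈⟨ ℚᵘ.*≡* (cong (ℤ._* + 1) (ℤ.pos-* m n)) ⟩
    ℚᵘ.mkℚᵘ (+ m) 0 ℚᵘ.* ℚᵘ.mkℚᵘ (+ n) 0    ≈⟨ ℚᵘ.*-cong (toℚᵘ-/ (+ m) 0) (toℚᵘ-/ (+ n) 0) ⟨
    toℚᵘ (ℕtoℚ m) ℚᵘ.* toℚᵘ (ℕtoℚ n)         ≈⟨ toℚᵘ-homo-* (ℕtoℚ m) (ℕtoℚ n) ⟨
    toℚᵘ (ℕtoℚ m * ℕtoℚ n)                    ∎)
    where open ℚᵘ.≃-Reasoning

  ℕtoℚ-suc : ∀ n → ℕtoℚ (suc n) ≡ 1ℚ + ℕtoℚ n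
  ℕtoℚ-suc = ℕtoℚ-+ 1

  ℕtoℚ-^ : ∀ n j → ℕtoℚ (n ℕ.^ j) ≡ ℕtoℚ n ^ℚ j
  ℕtoℚ-^ n zero    = refl
  ℕtoℚ-^ n (suc j) = trans (ℕtoℚ-* n (n ℕ.^ j)) (cong (ℕtoℚ n *_) (ℕtoℚ-^ n j))

  0≤ℕtoℚ : ∀ n → 0ℚ ≤ ℕtoℚ n
  0≤ℕtoℚ n = nonNegative⁻¹ _ {{normalize-nonNeg n 1}}

  ℕtoℚ-mono : ∀ {m n} → m ℕ.≤ n → ℕtoℚ m ≤ ℕtoℚ n
  ℕtoℚ-mono {m} {n} m≤n = ≤-by (ℕtoℚ (n ℕ.∸ m)) (0≤ℕtoℚ (n ℕ.∸ m))
    (trans (cong ℕtoℚ (sym (ℕ.m+[n∸m]≡n m≤n))) (ℕtoℚ-+ m (n ℕ.∸ m)))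

  ℕtoℚ-cancel : ∀ {m n} → ℕtoℚ m ≤ ℕtoℚ n → m ℕ.≤ n
  ℕtoℚ-cancel {m} {n} h with m ℕ.≤? n
  ... | yes m≤n = m≤n
  ... | no  m≰n = ⊥-elim (<-irrefl refl (<-≤-trans (<-by 1ℚ 0<1 refl)
    (≤-trans (≤-reflexive (+-comm (ℕtoℚ n) 1ℚ))
    (≤-trans (≤-reflexive (sym (ℕtoℚ-suc n))) (≤-trans (ℕtoℚ-mono (ℕ.≰⇒> m≰n)) h)))))

  0<inv : ∀ i → 0ℚ < inv i
  0<inv i = positive⁻¹ _ {{normalize-pos 1 (suc i)}}

  inv-inverse : ∀ i → inv i * ℕtoℚ (suc i) ≡ 1ℚ
  inv-inverse i = toℚᵘ-injective (begin
    toℚᵘ (inv i * ℕtoℚ (suc i))                        ≈⟨ toℚᵘ-homo-* (inv i) (ℕtoℚ (suc i)) ⟩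
    toℚᵘ (inv i) ℚᵘ.* toℚᵘ (ℕtoℚ (suc i))              ≈⟨ ℚᵘ.*-cong (toℚᵘ-/ (+ 1) i) (toℚᵘ-/ (+ suc i) 0) ⟩
    ℚᵘ.mkℚᵘ (+ 1) i ℚᵘ.* ℚᵘ.mkℚᵘ (+ suc i) 0          ≈⟨ ℚᵘ.*≡* (ℤ.*-assoc (+ 1) (+ suc i) (+ 1)) ⟩
    ℚᵘ.1ℚᵘ                                              ∎)
    where open ℚᵘ.≃-Reasoning

  inv-difference : ∀ i l → inv i ≡ inv l + inv i * inv l * (ℕtoℚ (suc l) - ℕtoℚ (suc i))
  inv-difference i l = begin
    inv i                                   ≡⟨ *-identityʳ (inv i) ⟨
    inv i * 1ℚ                              ≡⟨ cong (inv i *_) (inv-inverse l) ⟨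
    inv i * (inv l * ℕtoℚ (suc l))          ≡⟨ expand (inv i) (inv l) (ℕtoℚ (suc i)) (ℕtoℚ (suc l)) ⟩
    inv l * (inv i * ℕtoℚ (suc i)) + inv i * inv l * (ℕtoℚ (suc l) - ℕtoℚ (suc i))
      ≡⟨ cong (λ t → inv l * t + inv i * inv l * (ℕtoℚ (suc l) - ℕtoℚ (suc i))) (inv-inverse i) ⟩
    inv l * 1ℚ + inv i * inv l * (ℕtoℚ (suc l) - ℕtoℚ (suc i))
      ≡⟨ cong (_+ inv i * inv l * (ℕtoℚ (suc l) - ℕtoℚ (suc i))) (*-identityʳ (inv l)) ⟩
    inv l + inv i * inv l * (ℕtoℚ (suc l) - ℕtoℚ (suc i)) ∎
    where
    open ≡-Reasoning
    expand : ∀ a b x y → a * (b * y) ≡ b * (a * x) + a * b * (y - x)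
    expand = solve-∀ ring

  inv-suc< : ∀ i → inv (suc i) < inv i
  inv-suc< i = <-by (inv i * inv (suc i) * (ℕtoℚ (suc (suc i)) - ℕtoℚ (suc i)))
    (0<* (0<* (0<inv i) (0<inv (suc i)))
         (p<q⇒0<q-p (<-by 1ℚ 0<1 (trans (ℕtoℚ-suc (suc i)) (+-comm 1ℚ (ℕtoℚ (suc i)))))))
    (inv-difference i (suc i))

  -- Denominators are at least 1, so the numerator is already a bound, and 0 serves for a negative
  -- number.
  archimedean : ∀ x → ∃ λ N → x ≤ ℕtoℚ N
  archimedean x@(mkℚ (+ n) d _) = n , toℚᵘ-cancel-≤
    (ℚᵘ.≤-respʳ-≃ (ℚᵘ.≃-sym (toℚᵘ-/ (+ n) 0))
      (ℚᵘ.*≤* (ℤ.*-monoˡ-≤-nonNeg (+ n) (ℤ.+≤+ (ℕ.s≤s ℕ.z≤n)))))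
  archimedean x@(mkℚ -[1+ n ] d _) = 0 , <⇒≤ (negative⁻¹ x)

  -- Any `N` above `A / ε` works. This supplies the mesh sizes, tolerances and thresholds of the
  -- later arguments.
  inv-small : ∀ A {ε} → 0ℚ < ε → ∃ λ M → ∀ m → M ℕ.≤ m → A * inv m ≤ ε
  inv-small A {ε} 0<ε = N , bound
    where
    instance
      ε≢0 = >-nonZero 0<ε
    N = proj₁ (archimedean (A * 1/ ε))
    rearrange : ∀ e a r → e * (a * r) ≡ a * (e * r)
    rearrange = solve-∀ ring
    A≤ : ∀ m → N ℕ.≤ m → A ≤ ε * ℕtoℚ (suc m)
    A≤ m N≤m = ≤-trans
      (≤-reflexive (sym (trans (rearrange ε A (1/ ε)) (trans (cong (A *_) (*-inverseʳ ε)) (*-identityʳ A)))))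
      (*-monoˡ (<⇒≤ 0<ε) (≤-trans (proj₂ (archimedean (A * 1/ ε))) (ℕtoℚ-mono (ℕ.m≤n⇒m≤1+n N≤m))))
    cancel : ∀ e a r → e * a * r ≡ e * (r * a)
    cancel = solve-∀ ring
    bound : ∀ m → N ℕ.≤ m → A * inv m ≤ ε
    bound m N≤m = ≤-trans (*-monoʳ (<⇒≤ (0<inv m)) (A≤ m N≤m))
      (≤-reflexive (trans (cancel ε (ℕtoℚ (suc m)) (inv m)) (trans (cong (ε *_) (inv-inverse m)) (*-identityʳ ε))))

  0<^ : ∀ {q} → 0ℚ < q → ∀ n → 0ℚ < q ^ℚ n
  0<^ 0<q zero    = 0<1
  0<^ 0<q (suc n) = 0<* 0<q (0<^ 0<q n)

  ^-mono : ∀ {q r} → 0ℚ ≤ q → q ≤ r → ∀ n → 0ℚ ≤ q ^ℚ n × q ^ℚ n ≤ r ^ℚ n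
  ^-mono 0≤q q≤r zero    = <⇒≤ 0<1 , ≤-refl
  ^-mono 0≤q q≤r (suc n) =
    0≤* 0≤q 0≤qⁿ , ≤-trans (*-monoˡ 0≤q qⁿ≤rⁿ) (*-monoʳ (≤-trans 0≤qⁿ qⁿ≤rⁿ) q≤r)
    where
    0≤qⁿ = proj₁ (^-mono 0≤q q≤r n)
    qⁿ≤rⁿ = proj₂ (^-mono 0≤q q≤r n)

  ^-distrib-+ : ∀ q m n → q ^ℚ (m ℕ.+ n) ≡ q ^ℚ m * q ^ℚ n
  ^-distrib-+ q zero    n = sym (*-identityˡ _)
  ^-distrib-+ q (suc m) n = trans (cong (q *_) (^-distrib-+ q m n)) (sym (*-assoc q _ _))

  1^ : ∀ n → 1ℚ ^ℚ n ≡ 1ℚ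
  1^ zero    = refl
  1^ (suc n) = trans (*-identityˡ _) (1^ n)

  -- On the unit interval the derivative of the `n`-th power is at most `n`. The induction replaces
  -- one factor `r` by `q + δ` at a time and bounds the factors multiplying the errors by 1.
  ^-lipschitz : ∀ {q r δ} → 0ℚ ≤ q → q ≤ 1ℚ → 0ℚ ≤ r → r ≤ 1ℚ → 0ℚ ≤ δ → r ≤ q + δ →
    ∀ n → r ^ℚ n ≤ q ^ℚ n + ℕtoℚ n * δ
  ^-lipschitz {q} {r} {δ} 0≤q q≤1 0≤r r≤1 0≤δ r≤q+δ zero = ≤-by (0ℚ * δ) (0≤* ≤-refl 0≤δ) refl
  ^-lipschitz {q} {r} {δ} 0≤q q≤1 0≤r r≤1 0≤δ r≤q+δ (suc n) = begin
    r * r ^ℚ n                              ≤⟨ *-monoʳ 0≤rⁿ r≤q+δ ⟩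
    (q + δ) * r ^ℚ n                        ≡⟨ *-distribʳ-+ (r ^ℚ n) q δ ⟩
    q * r ^ℚ n + δ * r ^ℚ n                 ≤⟨ +-mono-≤ (*-monoˡ 0≤q (^-lipschitz 0≤q q≤1 0≤r r≤1 0≤δ r≤q+δ n))
                                                        (*-monoˡ 0≤δ rⁿ≤1) ⟩
    q * (q ^ℚ n + ℕtoℚ n * δ) + δ * 1ℚ      ≡⟨ expand q (q ^ℚ n) (ℕtoℚ n * δ) δ ⟩
    q * (ℕtoℚ n * δ) + (q * q ^ℚ n + δ)     ≤⟨ +-monoˡ-≤ (q * q ^ℚ n + δ) (*-monoʳ (0≤* (0≤ℕtoℚ n) 0≤δ) q≤1) ⟩
    1ℚ * (ℕtoℚ n * δ) + (q * q ^ℚ n + δ)    ≡⟨ collect (ℕtoℚ n) (q * q ^ℚ n) δ ⟩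
    q * q ^ℚ n + (1ℚ + ℕtoℚ n) * δ          ≡⟨ cong (λ t → q * q ^ℚ n + t * δ) (ℕtoℚ-suc n) ⟨
    q * q ^ℚ n + ℕtoℚ (suc n) * δ           ∎
    where
    open ≤-Reasoning
    0≤rⁿ = proj₁ (^-mono 0≤r r≤1 n)
    rⁿ≤1 = ≤-trans (proj₂ (^-mono 0≤r r≤1 n)) (≤-reflexive (1^ n))
    expand : ∀ q a b d → q * (a + b) + d * 1ℚ ≡ q * b + (q * a + d)
    expand = solve-∀ ring
    collect : ∀ n a d → 1ℚ * (n * d) + (a + d) ≡ a + (1ℚ + n) * d
    collect = solve-∀ ring

-- Approximate roots of sign-alternating polynomials, and approximate factorisation.

module RootExtraction where

  open import Data.Nat as ℕ using (ℕ; zero; suc)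
  import Data.Nat.Properties as ℕ
  open import Data.Rational
  open import Data.Rational.Properties
  open OrderedFieldℚ

  sg : ℕ → ℚ
  sg zero    = 1ℚ
  sg (suc i) = - sg i

  ∣sg*∣ : ∀ i x → ∣ sg i * x ∣ ≡ ∣ x ∣
  ∣sg*∣ zero    x = cong ∣_∣ (*-identityˡ x)
  ∣sg*∣ (suc i) x = trans (cong ∣_∣ (sym (neg-distribˡ-* (sg i) x))) (trans (∣-p∣≡∣p∣ _) (∣sg*∣ i x))

  -- T c k u = c k - c (k-1) u + c (k-2) u² - ⋯, evaluated by Horner's scheme.
  T : (ℕ → ℚ) → ℕ → ℚ → ℚ
  T c zero    u = c 0
  T c (suc k) u = c (suc k) - u * T c k u

  -- Synthetic division: the Horner values at y are the coefficients of the quotient by y - v.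
  T-divide : ∀ c y k v → T c (suc k) v ≡ (y - v) * T (λ i → T c i y) k v + T c (suc k) y
  T-divide c y zero v = identity (c 0) (c 1) y v
    where
    identity : ∀ a b y v → b - v * a ≡ (y - v) * a + (b - y * a)
    identity = solve-∀ ring
  T-divide c y (suc k) v = trans (cong (λ t → c (suc (suc k)) - v * t) (T-divide c y k v))
    (identity (c (suc (suc k))) y v (T (λ i → T c i y) k v) (T c (suc k) y))
    where
    identity : ∀ c y v B P → c - v * ((y - v) * B + P) ≡ (y - v) * (P - v * B) + (c - y * P)
    identity = solve-∀ ring

  ∣p*q∣≤ : ∀ {p q A B} → ∣ p ∣ ≤ A → ∣ q ∣ ≤ B → ∣ p * q ∣ ≤ A * B
  ∣p*q∣≤ {p} {q} p≤A q≤B = subst (_≤ _) (sym (∣p*q∣≡∣p∣*∣q∣ p q))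
    (≤-trans (*-monoʳ (0≤∣p∣ q) p≤A) (*-monoˡ (≤-trans (0≤∣p∣ p) p≤A) q≤B))

  T-bounded : ∀ c k U → ∃ λ B → ∀ x → ∣ x ∣ ≤ U → ∣ T c k x ∣ ≤ B
  T-bounded c zero    U = ∣ c 0 ∣ , λ x _ → ≤-refl
  T-bounded c (suc k) U with T-bounded c k U
  ... | B , bound = ∣ c (suc k) ∣ + U * B , λ x x≤U →
    ≤-trans (∣p-q∣≤∣p∣+∣q∣ (c (suc k)) (x * T c k x)) (+-monoʳ-≤ ∣ c (suc k) ∣ (∣p*q∣≤ x≤U (bound x x≤U)))

  -- A product rule along Horner's recursion: `x a - y b` is `x (a - b) + b (x - y)`, where the
  -- inductive constant controls the first summand and `T-bounded` the second.
  T-lipschitz : ∀ c k U → ∃ λ L → ∀ x y → ∣ x ∣ ≤ U → ∣ y ∣ ≤ U → ∣ T c k x - T c k y ∣ ≤ L * ∣ x - y ∣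
  T-lipschitz c zero    U = 0ℚ , λ x y _ _ →
    ≤-reflexive (trans (cong ∣_∣ (+-inverseʳ (c 0))) (sym (*-zeroˡ ∣ x - y ∣)))
  T-lipschitz c (suc k) U with T-lipschitz c k U | T-bounded c k U
  ... | L , lipschitz | B , bound = U * L + B , λ x y x≤U y≤U → begin
    ∣ T c (suc k) x - T c (suc k) y ∣
      ≡⟨ cong ∣_∣ (identity (c (suc k)) x y (T c k x) (T c k y)) ⟩
    ∣ - (x * (T c k x - T c k y)) - T c k y * (x - y) ∣
      ≤⟨ ∣p-q∣≤∣p∣+∣q∣ (- (x * (T c k x - T c k y))) (T c k y * (x - y)) ⟩
    ∣ - (x * (T c k x - T c k y)) ∣ + ∣ T c k y * (x - y) ∣
      ≡⟨ cong (_+ ∣ T c k y * (x - y) ∣) (∣-p∣≡∣p∣ (x * (T c k x - T c k y))) ⟩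
    ∣ x * (T c k x - T c k y) ∣ + ∣ T c k y * (x - y) ∣
      ≤⟨ +-mono-≤ (∣p*q∣≤ x≤U (lipschitz x y x≤U y≤U)) (∣p*q∣≤ (bound y y≤U) (≤-refl {∣ x - y ∣})) ⟩
    U * (L * ∣ x - y ∣) + B * ∣ x - y ∣
      ≡⟨ factorise U L B ∣ x - y ∣ ⟩
    (U * L + B) * ∣ x - y ∣ ∎
    where
    open ≤-Reasoning
    identity : ∀ c x y a b → (c - x * a) - (c - y * b) ≡ - (x * (a - b)) - b * (x - y)
    identity = solve-∀ ring
    factorise : ∀ U L B d → U * (L * d) + B * d ≡ (U * L + B) * d
    factorise = solve-∀ ring

  grid-step : ∀ a h n → a + ℕtoℚ (suc n) * h ≡ a + h + ℕtoℚ n * h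
  grid-step a h n = trans (cong (λ t → a + t * h) (ℕtoℚ-suc n)) (identity a h (ℕtoℚ n))
    where
    identity : ∀ a h n → a + (1ℚ + n) * h ≡ a + h + n * h
    identity = solve-∀ ring

  -- Walk along the grid of mesh `h` until `f` first fails to be positive. The order on the
  -- rationals is decidable, and reaching `b` without stopping would contradict `f b ≤ 0ℚ`.
  sign-change : ∀ (f : ℚ → ℚ) {h b} → 0ℚ ≤ h → f b ≤ 0ℚ → ∀ n a → a + ℕtoℚ n * h ≡ b → 0ℚ < f a →
    ∃ λ l → a ≤ l × l + h ≤ b × 0ℚ < f l × f (l + h) ≤ 0ℚ
  sign-change f {h} {b} 0≤h fb≤0 zero a end 0<fa = ⊥-elim (<-irrefl refl (<-≤-trans 0<fa
    (subst (λ t → f t ≤ 0ℚ) (trans (sym end) (trans (cong (a +_) (*-zeroˡ h)) (+-identityʳ a))) fb≤0)))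
  sign-change f {h} {b} 0≤h fb≤0 (suc n) a end 0<fa = by-cases (f (a + h) ≤? 0ℚ)
    where
    end' : a + h + ℕtoℚ n * h ≡ b
    end' = trans (sym (grid-step a h n)) end
    by-cases : Dec (f (a + h) ≤ 0ℚ) → ∃ λ l → a ≤ l × l + h ≤ b × 0ℚ < f l × f (l + h) ≤ 0ℚ
    by-cases (yes fa+h≤0) =
      a , ≤-refl , ≤-by (ℕtoℚ n * h) (0≤* (0≤ℕtoℚ n) 0≤h) (sym end') , 0<fa , fa+h≤0
    by-cases (no fa+h≰0) =
      let l , a+h≤l , rest = sign-change f 0≤h fb≤0 n (a + h) end' (≰⇒> fa+h≰0)
      in  l , ≤-trans (≤-by h 0≤h refl) a+h≤l , rest

  -- Take the right end of a grid cell on which the sign changes: as `f` is positive at the left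
  -- end, the Lipschitz bound over one mesh width limits how far below zero it can be. The right end
  -- also makes `a < y` strict.
  approximate-root : ∀ (f : ℚ → ℚ) {a b η} L → a < b →
    (∀ x y → a ≤ x → x ≤ y → y ≤ b → f x - f y ≤ L * (y - x)) →
    0ℚ < f a → f b ≤ 0ℚ → 0ℚ < η →
    ∃ λ y → a < y × y ≤ b × f y ≤ 0ℚ × - f y ≤ η
  approximate-root f {a} {b} {η} L a<b lipschitz 0<fa fb≤0 0<η =
    l + h , ≤-<-trans a≤l (<-by h 0<h refl) , l+h≤b , fy≤0 , (begin
      - f (l + h)            ≤⟨ ≤-by (f l) (<⇒≤ 0<fl) (+-comm (f l) (- f (l + h))) ⟩
      f l - f (l + h)        ≤⟨ lipschitz l (l + h) a≤l (≤-by h (<⇒≤ 0<h) refl) l+h≤b ⟩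
      L * (l + h - l)        ≡⟨ identity₂ L l (b - a) (inv M) ⟩
      L * (b - a) * inv M    ≤⟨ proj₂ small M ℕ.≤-refl ⟩
      η                      ∎)
    where
    open ≤-Reasoning
    small = inv-small (L * (b - a)) 0<η
    M = proj₁ small
    h = (b - a) * inv M
    0<h : 0ℚ < h
    0<h = 0<* (p<q⇒0<q-p a<b) (0<inv M)
    identity₁ : ∀ a b i n → a + n * ((b - a) * i) ≡ a + (b - a) * (i * n)
    identity₁ = solve-∀ ring
    identity₂ : ∀ L l d i → L * (l + d * i - l) ≡ L * d * i
    identity₂ = solve-∀ ring
    cancel : ∀ a b → a + (b - a) * 1ℚ ≡ b
    cancel = solve-∀ ring
    end : a + ℕtoℚ (suc M) * h ≡ b
    end = trans (identity₁ a b (inv M) (ℕtoℚ (suc M)))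
      (trans (cong (λ t → a + (b - a) * t) (inv-inverse M)) (cancel a b))
    cross = sign-change f (<⇒≤ 0<h) fb≤0 (suc M) a end 0<fa
    l = proj₁ cross
    a≤l = proj₁ (proj₂ cross)
    l+h≤b = proj₁ (proj₂ (proj₂ cross))
    0<fl = proj₁ (proj₂ (proj₂ (proj₂ cross)))
    fy≤0 = proj₂ (proj₂ (proj₂ (proj₂ cross)))

  ½p<p : ∀ {p} → 0ℚ < p → ½ * p < p
  ½p<p {p} 0<p = <-by (½ * p) (0<* 0<½ 0<p) (identity p)
    where
    identity : ∀ p → p ≡ ½ * p + ½ * p
    identity = solve-∀ ring

  0<⊓ : ∀ {p q} → 0ℚ < p → 0ℚ < q → 0ℚ < p ⊓ q
  0<⊓ {p} {q} 0<p 0<q = by-cases (⊓-sel p q)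
    where
    by-cases : p ⊓ q ≡ p ⊎ p ⊓ q ≡ q → 0ℚ < p ⊓ q
    by-cases (inj₁ e) = subst (0ℚ <_) (sym e) 0<p
    by-cases (inj₂ e) = subst (0ℚ <_) (sym e) 0<q

  -- Half of the minimum of finitely many positive numbers; the halving makes the bound strict. The
  -- index pairs with sum `k` are those of `Alternating`.
  positive-minorant : ∀ k (g : ℕ → ℕ → ℚ) → (∀ j i → j ℕ.+ i ≡ k → 0ℚ < g j i) →
    ∃ λ η → 0ℚ < η × ∀ j i → j ℕ.+ i ≡ k → η < g j i
  positive-minorant zero g 0<g = ½ * g 0 0 , 0<* 0<½ (0<g 0 0 refl) , λ { zero zero _ → ½p<p (0<g 0 0 refl) }
  positive-minorant (suc k) g 0<g =
    η₀ ⊓ η₁ , 0<⊓ (0<* 0<½ (0<g 0 (suc k) refl)) (proj₁ (proj₂ rec)) , bound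
    where
    rec = positive-minorant k (g ∘ suc) (λ j i e → 0<g (suc j) i (cong suc e))
    η₀ = ½ * g 0 (suc k)
    η₁ = proj₁ rec
    bound : ∀ j i → j ℕ.+ i ≡ suc k → η₀ ⊓ η₁ < g j i
    bound zero    .(suc k) refl = ≤-<-trans (p⊓q≤p η₀ η₁) (½p<p (0<g 0 (suc k) refl))
    bound (suc j) i        e    = ≤-<-trans (p⊓q≤q η₀ η₁) (proj₂ (proj₂ rec) j i (ℕ.suc-injective e))

  esymℚ : ∀ {k} → Vec ℚ k → ℕ → ℚ
  esymℚ a       zero    = 1ℚ
  esymℚ []      (suc j) = 0ℚ
  esymℚ (y ∷ a) (suc j) = esymℚ a (suc j) + y * esymℚ a j

  esymℚ-beyond : ∀ {k} (a : Vec ℚ k) {j} → k ℕ.< j → esymℚ a j ≡ 0ℚ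
  esymℚ-beyond []      {suc j} _             = refl
  esymℚ-beyond (y ∷ a) {suc j} (ℕ.s≤s k<j) = trans
    (cong₂ (λ s t → s + y * t) (esymℚ-beyond a (ℕ.m<n⇒m<1+n k<j)) (esymℚ-beyond a k<j))
    (trans (+-identityˡ (y * 0ℚ)) (*-zeroʳ y))

  -- The sign of T c k at the j-th largest point is (-1)^(k-j).
  Alternating : ℕ → (ℕ → ℚ) → (ℕ → ℚ) → Set
  Alternating k c u = ∀ j i → j ℕ.+ i ≡ k → 0ℚ < sg i * T c k (u j)

  -- There is a sign change between the two largest points `u 1` and `u 0`, hence an approximate
  -- root `y` there. Dividing by `y - v` leaves the remainder `δ`; if `δ` is smaller than every
  -- value at the remaining points, the quotient keeps their signs, because `y - v` is positive at
  -- all of them.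
  extract-root : ∀ k c u → (∀ j → 0ℚ < u j) → (∀ j → u (suc j) < u j) → Alternating (suc k) c u →
    ∀ {ε} → 0ℚ < ε → ∃ λ y → u 1 < y × ∣ T c (suc k) y ∣ ≤ ε × Alternating k (λ i → T c i y) (u ∘ suc)
  extract-root k c u 0<u decreasing alt {ε} 0<ε = y , u₁<y , ≤-trans ∣δ∣≤η (p⊓q≤p ε η₁) , alternating
    where
    -- The factor `sg k` makes `f` positive at `u 1` and negative at `u 0`, whatever the parity of
    -- `k`.
    f : ℚ → ℚ
    f v = sg k * T c (suc k) v
    lip = T-lipschitz c (suc k) (u 0)
    L = proj₁ lip
    -- The margin by which the values at the remaining points avoid zero; the remainder is kept
    -- below it as well as below `ε`.
    minorant = positive-minorant k (λ j i → sg i * T c (suc k) (u (suc j))) (λ j i e → alt (suc j) i (cong suc e))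
    η₁ = proj₁ minorant
    η = ε ⊓ η₁
    f-lipschitz : ∀ x y → u 1 ≤ x → x ≤ y → y ≤ u 0 → f x - f y ≤ L * (y - x)
    f-lipschitz x y u₁≤x x≤y y≤u₀ = begin
      f x - f y                                       ≡⟨ identity (sg k) (T c (suc k) x) (T c (suc k) y) ⟩
      sg k * (T c (suc k) x - T c (suc k) y)          ≤⟨ p≤∣p∣ _ ⟩
      ∣ sg k * (T c (suc k) x - T c (suc k) y) ∣      ≡⟨ ∣sg*∣ k _ ⟩
      ∣ T c (suc k) x - T c (suc k) y ∣
        ≤⟨ proj₂ lip x y (∣∣≤u₀ 0≤x (≤-trans x≤y y≤u₀)) (∣∣≤u₀ (≤-trans 0≤x x≤y) y≤u₀) ⟩
      L * ∣ x - y ∣                                   ≡⟨ cong (L *_) (trans (sym (∣-p∣≡∣p∣ (x - y))) (cong ∣_∣ (flip x y))) ⟩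
      L * ∣ y - x ∣                                   ≡⟨ cong (L *_) (0≤p⇒∣p∣≡p (p≤q⇒0≤q-p x≤y)) ⟩
      L * (y - x)                                     ∎
      where
      open ≤-Reasoning
      identity : ∀ s a b → s * a - s * b ≡ s * (a - b)
      identity = solve-∀ ring
      flip : ∀ x y → - (x - y) ≡ y - x
      flip = solve-∀ ring
      0≤x = ≤-trans (<⇒≤ (0<u 1)) u₁≤x
      ∣∣≤u₀ : ∀ {x} → 0ℚ ≤ x → x ≤ u 0 → ∣ x ∣ ≤ u 0
      ∣∣≤u₀ 0≤x x≤u₀ = subst (_≤ u 0) (sym (0≤p⇒∣p∣≡p 0≤x)) x≤u₀
    f₀≤0 : f (u 0) ≤ 0ℚ
    f₀≤0 = ≤-by (- sg k * T c (suc k) (u 0)) (<⇒≤ (alt 0 (suc k) refl)) (identity (sg k) (T c (suc k) (u 0)))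
      where
      identity : ∀ s t → 0ℚ ≡ s * t + - s * t
      identity = solve-∀ ring
    root = approximate-root f L (decreasing 0) f-lipschitz (alt 1 k refl) f₀≤0 (0<⊓ 0<ε (proj₁ (proj₂ minorant)))
    y = proj₁ root
    u₁<y = proj₁ (proj₂ root)
    δ = T c (suc k) y
    ∣δ∣≤η : ∣ δ ∣ ≤ η
    ∣δ∣≤η = subst (_≤ η) (∣sg*∣ k δ) (∣p∣≤
      (≤-trans (proj₁ (proj₂ (proj₂ (proj₂ root)))) (<⇒≤ (0<⊓ 0<ε (proj₁ (proj₂ minorant)))))
      (proj₂ (proj₂ (proj₂ (proj₂ root)))))
    below : ∀ j → u (suc j) ≤ u 1
    below zero    = ≤-refl
    below (suc j) = ≤-trans (<⇒≤ (decreasing (suc j))) (below j)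
    alternating : Alternating k (λ i → T c i y) (u ∘ suc)
    -- After subtracting the signed remainder, the value at `u (suc j)` is still positive and equals
    -- `y - v` times the signed quotient; cancel the positive factor.
    alternating j i e = 0<*⁻ (p<q⇒0<q-p (≤-<-trans (below j) u₁<y))
      (subst (0ℚ <_) split (p<q⇒0<q-p (begin-strict
        sg i * δ                        ≤⟨ p≤∣p∣ (sg i * δ) ⟩
        ∣ sg i * δ ∣                    ≡⟨ ∣sg*∣ i δ ⟩
        ∣ δ ∣                           ≤⟨ ≤-trans ∣δ∣≤η (p⊓q≤q ε η₁) ⟩
        η₁                              <⟨ proj₂ (proj₂ minorant) j i e ⟩
        sg i * T c (suc k) (u (suc j))  ∎)))
      where
      open ≤-Reasoning
      v = u (suc j)
      B = T (λ i → T c i y) k v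
      identity : ∀ s y v B d → s * ((y - v) * B + d) - s * d ≡ (y - v) * (s * B)
      identity = solve-∀ ring
      split : sg i * T c (suc k) v - sg i * δ ≡ (y - v) * (sg i * B)
      split = trans (cong (λ t → sg i * t - sg i * δ) (T-divide c y k v)) (identity (sg i) y v B δ)

  -- If `c` were the elementary symmetric functions of `a`, then `T c` would be the product of the
  -- factors `a i - u`, so the entries of `a` are sought as roots. Each extraction drops only the
  -- last Horner value, which spoils no coefficient of degree 1: hence `esymℚ a 1` is exact, and the
  -- part sizes will add up without error.
  approximate-factorisation : ∀ k c u → c 0 ≡ 1ℚ → (∀ j → 0ℚ < u j) → (∀ j → u (suc j) < u j) →
    Alternating (suc k) c u → ∀ {ε} → 0ℚ < ε →
    ∃ λ (a : Vec ℚ (suc k)) → u 1 < head a × All (0ℚ ≤_) a × esymℚ a 1 ≡ c 1 ×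
      ∀ j → j ℕ.≤ suc k → ∣ esymℚ a j - c j ∣ ≤ ε
  approximate-factorisation zero c u c₀≡1 0<u decreasing alt {ε} 0<ε =
    -- The remaining polynomial is `c 1 - u` since `c 0` is 1; its root is exact, and its positive
    -- sign at `u 1` puts the root above `u 1`.
    c 1 ∷ [] , u₁<c₁ , <⇒≤ (<-trans (0<u 1) u₁<c₁) ∷ [] , exact (c 1) , error
    where
    identity : ∀ a u → 1ℚ * (a - u * 1ℚ) ≡ a - u
    identity = solve-∀ ring
    exact : ∀ a → 0ℚ + a * 1ℚ ≡ a
    exact = solve-∀ ring
    u₁<c₁ : u 1 < c 1
    u₁<c₁ = <-by (c 1 - u 1)
      (subst (0ℚ <_) (trans (cong (λ t → 1ℚ * (c 1 - u 1 * t)) c₀≡1) (identity (c 1) (u 1))) (alt 1 0 refl))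
      (add-sub (c 1) (u 1))
      where
      add-sub : ∀ a u → a ≡ u + (a - u)
      add-sub = solve-∀ ring
    no-error : ∀ {x y} → x ≡ y → ∣ x - y ∣ ≤ ε
    no-error {x} refl = subst (λ t → ∣ t ∣ ≤ ε) (sym (+-inverseʳ x)) (<⇒≤ 0<ε)
    error : ∀ j → j ℕ.≤ 1 → ∣ esymℚ (c 1 ∷ []) j - c j ∣ ≤ ε
    error zero          _ = no-error (sym c₀≡1)
    error (suc zero)    _ = no-error (exact (c 1))
    error (suc (suc j)) (ℕ.s≤s ())
  approximate-factorisation (suc k) c u c₀≡1 0<u decreasing alt {ε} 0<ε =
    y ∷ a , u₁<y , 0≤y ∷ proj₁ (proj₂ (proj₂ rec)) , exact , error
    where
    0<½ε = 0<* 0<½ 0<ε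
    extracted = extract-root (suc k) c u 0<u decreasing alt 0<½ε
    y = proj₁ extracted
    u₁<y = proj₁ (proj₂ extracted)
    0≤y = <⇒≤ (<-trans (0<u 1) u₁<y)
    b : ℕ → ℚ
    b i = T c i y
    -- Half of `ε` goes to the dropped remainder. The recursive tolerance `ε'` enters once directly
    -- and once multiplied by `y`, and must fit into the other half.
    small = inv-small (1ℚ + y) 0<½ε
    ε' = inv (proj₁ small)
    0≤ε' = <⇒≤ (0<inv (proj₁ small))
    ε'+yε'≤½ε : ε' + y * ε' ≤ ½ * ε
    ε'+yε'≤½ε = ≤-trans (≤-reflexive (identity y ε')) (proj₂ small (proj₁ small) ℕ.≤-refl)
      where
      identity : ∀ y e → e + y * e ≡ (1ℚ + y) * e
      identity = solve-∀ ring
    rec = approximate-factorisation k b (u ∘ suc) c₀≡1 (0<u ∘ suc) (decreasing ∘ suc)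
      (proj₂ (proj₂ (proj₂ extracted))) (0<inv (proj₁ small))
    a = proj₁ rec
    rec-error = proj₂ (proj₂ (proj₂ (proj₂ rec)))
    exact : esymℚ a 1 + y * 1ℚ ≡ c 1
    exact = trans (cong (_+ y * 1ℚ) (proj₁ (proj₂ (proj₂ (proj₂ rec)))))
      (trans (cong (λ t → c 1 - y * t + y * 1ℚ) c₀≡1) (identity (c 1) y))
      where
      identity : ∀ c y → c - y * 1ℚ + y * 1ℚ ≡ c
      identity = solve-∀ ring
    -- In the top degree `j = suc (suc k)` the vector `a` is too short and `esymℚ a j` vanishes; the
    -- error is then exactly the dropped remainder `b j`.
    upper : ∀ j → j ℕ.≤ suc (suc k) → ∣ esymℚ a j - b j ∣ ≤ ½ * ε
    upper j j≤ = by-cases (ℕ.m≤n⇒m<n∨m≡n j≤)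
      where
      by-cases : j ℕ.< suc (suc k) ⊎ j ≡ suc (suc k) → ∣ esymℚ a j - b j ∣ ≤ ½ * ε
      by-cases (inj₁ (ℕ.s≤s j≤k)) =
        ≤-trans (rec-error j j≤k) (≤-trans (≤-by (y * ε') (0≤* 0≤y 0≤ε') refl) ε'+yε'≤½ε)
      by-cases (inj₂ refl) = subst (_≤ ½ * ε)
        (sym (trans (cong (λ t → ∣ t - b j ∣) (esymℚ-beyond a ℕ.≤-refl))
                    (trans (cong ∣_∣ (+-identityˡ (- b j))) (∣-p∣≡∣p∣ (b j)))))
        (proj₁ (proj₂ (proj₂ extracted)))
    error : ∀ j → j ℕ.≤ suc (suc k) → ∣ esymℚ (y ∷ a) j - c j ∣ ≤ ε
    error zero    _            = subst (λ t → ∣ 1ℚ - t ∣ ≤ ε) (sym c₀≡1) (<⇒≤ 0<ε)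
    error (suc j) (ℕ.s≤s j≤k) = begin
      ∣ esymℚ a (suc j) + y * esymℚ a j - c (suc j) ∣
        ≡⟨ cong ∣_∣ (identity (esymℚ a (suc j)) (esymℚ a j) y (c (suc j)) (b j)) ⟩
      ∣ (esymℚ a (suc j) - b (suc j)) + y * (esymℚ a j - b j) ∣
        ≤⟨ ∣p+q∣≤∣p∣+∣q∣ (esymℚ a (suc j) - b (suc j)) (y * (esymℚ a j - b j)) ⟩
      ∣ esymℚ a (suc j) - b (suc j) ∣ + ∣ y * (esymℚ a j - b j) ∣
        ≤⟨ +-mono-≤ (upper (suc j) (ℕ.s≤s j≤k)) (∣p*q∣≤ (≤-reflexive (0≤p⇒∣p∣≡p 0≤y)) (rec-error j j≤k)) ⟩
      ½ * ε + y * ε'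
        ≤⟨ +-monoʳ-≤ (½ * ε) (≤-trans (≤-by ε' 0≤ε' (+-comm ε' (y * ε'))) ε'+yε'≤½ε) ⟩
      ½ * ε + ½ * ε
        ≡⟨ halves ε ⟩
      ε ∎
      where
      open ≤-Reasoning
      identity : ∀ p q y c b → p + y * q - c ≡ (p - (c - y * b)) + y * (q - b)
      identity = solve-∀ ring
      halves : ∀ e → ½ * e + ½ * e ≡ e
      halves = solve-∀ ring

-- Sign alternation for coefficients whose successive ratios fall by more than a factor 4.

module SignPattern where

  open import Data.Nat as ℕ using (ℕ; zero; suc)
  import Data.Nat.Properties as ℕ
  open import Data.Rational
  open import Data.Rational.Properties
  open OrderedFieldℚ
  open RootExtraction

  4ℚ : ℚ
  4ℚ = 2ℚ + 2ℚ

  module _ (ρ : ℕ → ℚ) (0<ρ : ∀ i → 0ℚ < ρ i) (4ρ<ρ : ∀ i → 4ℚ * ρ (suc i) < ρ i) where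

    partial-product : ℕ → ℚ
    partial-product zero    = 1ℚ
    partial-product (suc i) = ρ (suc i) * partial-product i

    private e = partial-product

    0<e : ∀ i → 0ℚ < e i
    0<e zero    = 0<1
    0<e (suc i) = 0<* (0<ρ (suc i)) (0<e i)

    ρ-decreasing : ∀ i → ρ (suc i) < ρ i
    ρ-decreasing i = ≤-<-trans
      (≤-by (ρ (suc i) + 2ℚ * ρ (suc i)) (0≤+ (<⇒≤ (0<ρ (suc i))) (0≤* (<⇒≤ (positive⁻¹ 2ℚ)) (<⇒≤ (0<ρ (suc i)))))
        (identity (ρ (suc i))))
      (4ρ<ρ i)
      where
      identity : ∀ r → 4ℚ * r ≡ r + (r + 2ℚ * r)
      identity = solve-∀ ring

    ρ-antitone : ∀ j i → ρ (j ℕ.+ i) ≤ ρ j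
    ρ-antitone j zero    = ≤-reflexive (cong ρ (ℕ.+-identityʳ j))
    ρ-antitone j (suc i) = ≤-trans (≤-reflexive (cong ρ (ℕ.+-suc j i)))
      (≤-trans (<⇒≤ (ρ-decreasing (j ℕ.+ i))) (ρ-antitone j i))

    -- For `u ≤ ρ n` the terms of the alternating sum decrease in size from `e n` onwards, so the
    -- sum lies between 0 and its first term, as in Leibniz's criterion.
    T-small : ∀ n u → 0ℚ ≤ u → u ≤ ρ n → 0ℚ ≤ T e n u × T e n u ≤ e n
    T-small zero    u 0≤u u≤ρ = <⇒≤ 0<1 , ≤-refl
    T-small (suc n) u 0≤u u≤ρ =
      p≤q⇒0≤q-p (≤-trans (*-monoˡ 0≤u T≤e) (*-monoʳ (<⇒≤ (0<e n)) u≤ρ)) ,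
      ≤-by (u * T e n u) (0≤* 0≤u 0≤T) (add-sub (e (suc n)) (u * T e n u))
      where
      rec = T-small n u 0≤u (≤-trans u≤ρ (<⇒≤ (ρ-decreasing n)))
      0≤T = proj₁ rec
      T≤e = proj₂ rec
      add-sub : ∀ a b → a ≡ a - b + b
      add-sub = solve-∀ ring

    -- One Horner step subtracts at most half of `ρ j` times the previous partial product, that is,
    -- half of `e j`.
    T-diagonal : ∀ j → ½ * e j ≤ T e j (½ * ρ j)
    T-diagonal zero    = <⇒≤ (½p<p 0<1)
    T-diagonal (suc j) = ≤-by (½ * r * (e j - T e j (½ * r)))
      (0≤* (<⇒≤ (0<* 0<½ (0<ρ (suc j)))) (p≤q⇒0≤q-p (proj₂ small)))
      (identity r (e j) (T e j (½ * r)))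
      where
      r = ρ (suc j)
      small = T-small j (½ * r) (<⇒≤ (0<* 0<½ (0<ρ (suc j)))) (≤-trans (<⇒≤ (½p<p (0<ρ (suc j)))) (<⇒≤ (ρ-decreasing j)))
      identity : ∀ r e t → r * e - ½ * r * t ≡ ½ * (r * e) + ½ * r * (e - t)
      identity = solve-∀ ring

    module _ (j : ℕ) where
      private u = ½ * ρ j

      -- With `n = j + i`, the new value is at most `ρ (suc n) * e n` minus `½ * ρ j` times
      -- `½ * e n`. The two halves make a quarter, and `4 ρ (suc n) < ρ n ≤ ρ j` makes the result
      -- negative: this is where the factor 4 is needed.
      T-negative : ∀ i → ½ * e (j ℕ.+ i) ≤ T e (j ℕ.+ i) u → 0ℚ < - T e (suc (j ℕ.+ i)) u
      T-negative i ½e≤T = <-≤-trans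
        (0<* (0<* (0<* 0<½ 0<½) (0<e n)) (p<q⇒0<q-p (<-≤-trans (4ρ<ρ n) (ρ-antitone j i))))
        (≤-by (u * (T e n u - ½ * e n)) (0≤* (<⇒≤ (0<* 0<½ (0<ρ j))) (p≤q⇒0≤q-p ½e≤T))
          (identity (ρ (suc n)) (ρ j) (e n) (T e n u)))
        where
        n = j ℕ.+ i
        identity : ∀ s r e t → - (s * e - ½ * r * t) ≡ ½ * ½ * e * (r - 4ℚ * s) + ½ * r * (t - ½ * e)
        identity = solve-∀ ring

      -- Subtracting `u` times a negative value only adds, so the lower bound by half of the
      -- coefficient is restored two degrees higher.
      T-positive : ∀ i → ½ * e (j ℕ.+ i) ≤ T e (j ℕ.+ i) u →
        ½ * e (suc (suc (j ℕ.+ i))) ≤ T e (suc (suc (j ℕ.+ i))) u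
      T-positive i ½e≤T = ≤-trans (<⇒≤ (½p<p (0<e (suc (suc n)))))
        (≤-by (u * - T e (suc n) u) (0≤* (<⇒≤ (0<* 0<½ (0<ρ j))) (<⇒≤ (T-negative i ½e≤T)))
          (identity (e (suc (suc n))) u (T e (suc n) u)))
        where
        n = j ℕ.+ i
        identity : ∀ a u t → a - u * t ≡ a + u * - t
        identity = solve-∀ ring

      -- Induction in steps of two: the lower bound holds at even distances from the start, and each
      -- odd distance is handled by `T-negative`.
      T-signs : ∀ l i → ½ * e (j ℕ.+ i) ≤ T e (j ℕ.+ i) u → 0ℚ < sg l * T e (l ℕ.+ (j ℕ.+ i)) u
      T-signs zero          i h = subst (0ℚ <_) (sym (*-identityˡ _)) (<-≤-trans (0<* 0<½ (0<e (j ℕ.+ i))) h)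
      T-signs (suc zero)    i h = subst (0ℚ <_) (neg1 (T e (suc (j ℕ.+ i)) u)) (T-negative i h)
        where
        neg1 : ∀ t → - t ≡ - 1ℚ * t
        neg1 = solve-∀ ring
      T-signs (suc (suc l)) i h = subst (0ℚ <_) (cong₂ _*_ (neg-neg (sg l)) (cong (λ n → T e n u) index))
        (T-signs l (suc (suc i)) (subst (λ n → ½ * e n ≤ T e n u) (sym j+2+i) (T-positive i h)))
        where
        neg-neg : ∀ s → s ≡ - - s
        neg-neg = solve-∀ ring
        j+2+i : j ℕ.+ suc (suc i) ≡ suc (suc (j ℕ.+ i))
        j+2+i = trans (ℕ.+-suc j (suc i)) (cong suc (ℕ.+-suc j i))
        index : l ℕ.+ (j ℕ.+ suc (suc i)) ≡ suc (suc (l ℕ.+ (j ℕ.+ i)))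
        index = trans (cong (l ℕ.+_) j+2+i) (trans (ℕ.+-suc l (suc (j ℕ.+ i))) (cong suc (ℕ.+-suc l (j ℕ.+ i))))

    partial-product-alternating : ∀ k → Alternating k e (λ j → ½ * ρ j)
    partial-product-alternating k j i j+i≡k =
      subst (λ n → 0ℚ < sg i * T e n (½ * ρ j)) index
        (T-signs j i 0 (subst (λ n → ½ * e n ≤ T e n (½ * ρ j)) (sym (ℕ.+-identityʳ j)) (T-diagonal j)))
      where
      index : i ℕ.+ (j ℕ.+ 0) ≡ k
      index = trans (cong (i ℕ.+_) (ℕ.+-identityʳ j)) (trans (ℕ.+-comm i j) j+i≡k)

-- Coefficients from clique densities, integer part sizes, and the graphs.

module Construction where

  open import Data.Nat as ℕ using (ℕ; zero; suc; _!)
  import Data.Nat.Properties as ℕ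
  open import Data.Rational
  open import Data.Rational.Properties
  open import Data.Integer using (+_; -[1+_])
  import Data.Integer as ℤ
  import Data.Integer.Properties as ℤ
  import Data.Rational.Unnormalised as ℚᵘ
  import Data.Rational.Unnormalised.Properties as ℚᵘ
  import Data.Nat.Tactic.RingSolver as ℕRing
  open import Data.Nat.DivMod using (+-distrib-/-∣ʳ; m*n/n≡m)
  open import Data.Nat.Divisibility using (n∣m*n)
  open import Data.Vec.Properties using (∷-injective)
  open CompleteMultipartite
  open OrderedFieldℚ
  open RootExtraction
  open SignPattern

  choose2-suc : ∀ j → choose2 (suc j) ≡ j ℕ.+ choose2 j
  choose2-suc zero    = refl
  choose2-suc (suc i) = begin
    suc (suc i) ℕ.* suc i ℕ./ 2                      ≡⟨ cong (ℕ._/ 2) (expand i) ⟩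
    (suc i ℕ.* i ℕ.+ suc i ℕ.* 2) ℕ./ 2              ≡⟨ +-distrib-/-∣ʳ (suc i ℕ.* i) (n∣m*n (suc i)) ⟩
    suc i ℕ.* i ℕ./ 2 ℕ.+ suc i ℕ.* 2 ℕ./ 2          ≡⟨ cong (suc i ℕ.* i ℕ./ 2 ℕ.+_) (m*n/n≡m (suc i) 2) ⟩
    suc i ℕ.* i ℕ./ 2 ℕ.+ suc i                      ≡⟨ ℕ.+-comm _ (suc i) ⟩
    suc i ℕ.+ suc i ℕ.* i ℕ./ 2                      ∎
    where
    open ≡-Reasoning
    expand : ∀ i → suc (suc i) ℕ.* suc i ≡ suc i ℕ.* i ℕ.+ suc i ℕ.* 2
    expand = ℕRing.solve-∀

  -- For i ≥ 1, ratio q i is the quotient of consecutive terms q^C(i,2) / i!; the value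
  -- at 0 is arbitrary above 4 and only supplies a point beyond the largest root.
  ratio : ℚ → ℕ → ℚ
  ratio q zero    = 4ℚ + 1ℚ
  ratio q (suc i) = q ^ℚ i * inv i

  module _ {q : ℚ} (0<q : 0ℚ < q) (q≤¼ : q ≤ (+ 1) / 4) where

    0<ratio : ∀ i → 0ℚ < ratio q i
    0<ratio zero    = positive⁻¹ (4ℚ + 1ℚ)
    0<ratio (suc i) = 0<* (0<^ 0<q i) (0<inv i)

    4ratio<ratio : ∀ i → 4ℚ * ratio q (suc i) < ratio q i
    4ratio<ratio zero    = <-by 1ℚ 0<1 refl
    4ratio<ratio (suc i) = <-by
      (q ^ℚ i * (inv i - inv (suc i)) + q ^ℚ i * inv (suc i) * (1ℚ - 4ℚ * q))
      (0<+ (0<* (0<^ 0<q i) (p<q⇒0<q-p (inv-suc< i)))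
           (0≤* (<⇒≤ (0<* (0<^ 0<q i) (0<inv (suc i)))) (p≤q⇒0≤q-p (*-monoˡ {4ℚ} (<⇒≤ (positive⁻¹ 4ℚ)) q≤¼))))
      (identity q (q ^ℚ i) (inv i) (inv (suc i)))
      where
      identity : ∀ q r a b → r * a ≡ 4ℚ * (q * r * b) + (r * (a - b) + r * b * (1ℚ - 4ℚ * q))
      identity = solve-∀ ring

    coefficient : ℕ → ℚ
    coefficient = partial-product (ratio q) 0<ratio 4ratio<ratio

    !*coefficient : ∀ j → ℕtoℚ (j !) * coefficient j ≡ q ^ℚ choose2 j
    !*coefficient zero    = refl
    !*coefficient (suc j) = begin
      ℕtoℚ (suc j ℕ.* j !) * (q ^ℚ j * inv j * coefficient j)
        ≡⟨ cong (_* (q ^ℚ j * inv j * coefficient j)) (ℕtoℚ-* (suc j) (j !)) ⟩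
      ℕtoℚ (suc j) * ℕtoℚ (j !) * (q ^ℚ j * inv j * coefficient j)
        ≡⟨ identity (ℕtoℚ (suc j)) (ℕtoℚ (j !)) (q ^ℚ j) (inv j) (coefficient j) ⟩
      inv j * ℕtoℚ (suc j) * (q ^ℚ j * (ℕtoℚ (j !) * coefficient j))
        ≡⟨ cong₂ (λ s t → s * (q ^ℚ j * t)) (inv-inverse j) (!*coefficient j) ⟩
      1ℚ * (q ^ℚ j * q ^ℚ choose2 j)
        ≡⟨ *-identityˡ _ ⟩
      q ^ℚ j * q ^ℚ choose2 j
        ≡⟨ ^-distrib-+ q j (choose2 j) ⟨
      q ^ℚ (j ℕ.+ choose2 j)
        ≡⟨ cong (q ^ℚ_) (choose2-suc j) ⟨
      q ^ℚ choose2 (suc j) ∎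
      where
      open ≡-Reasoning
      identity : ∀ s f r i c → s * f * (r * i * c) ≡ i * s * (r * (f * c))
      identity = solve-∀ ring

  clear-denominator : ∀ y → 0ℚ ≤ y → ∃ λ d → ∃ λ n → ℕtoℚ (suc d) * y ≡ ℕtoℚ n
  clear-denominator y@(mkℚ (+ n) d _) _ = d , n , toℚᵘ-injective (begin
    toℚᵘ (ℕtoℚ (suc d) * y)                    ≈⟨ toℚᵘ-homo-* (ℕtoℚ (suc d)) y ⟩
    toℚᵘ (ℕtoℚ (suc d)) ℚᵘ.* toℚᵘ y            ≈⟨ ℚᵘ.*-congʳ (toℚᵘ-/ (+ suc d) 0) ⟩
    ℚᵘ.mkℚᵘ (+ suc d) 0 ℚᵘ.* ℚᵘ.mkℚᵘ (+ n) d  ≈⟨ ℚᵘ.*≡* cross ⟩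
    ℚᵘ.mkℚᵘ (+ n) 0                            ≈⟨ toℚᵘ-/ (+ n) 0 ⟨
    toℚᵘ (ℕtoℚ n)                              ∎)
    where
    open ℚᵘ.≃-Reasoning
    cross : + suc d ℤ.* + n ℤ.* + 1 ≡ + n ℤ.* (+ 1 ℤ.* + suc d)
    cross = trans (ℤ.*-identityʳ _) (trans (ℤ.*-comm (+ suc d) (+ n)) (cong (+ n ℤ.*_) (sym (ℤ.*-identityˡ (+ suc d)))))
  clear-denominator y@(mkℚ -[1+ n ] d _) 0≤y = ⊥-elim (<-irrefl refl (≤-<-trans 0≤y (negative⁻¹ y)))

  -- All multiples `m` of the common denominator are provided at once: the recursion needs a
  -- multiple that absorbs the denominator of `y`, and the construction needs arbitrarily many
  -- vertices.
  clear-denominators : ∀ {k} (a : Vec ℚ k) → All (0ℚ ≤_) a →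
    ∃ λ D → ∀ m → ∃ λ (s : Vec ℕ k) → Vec.map ℕtoℚ s ≡ Vec.map (ℕtoℚ (m ℕ.* suc D) *_) a
  clear-denominators []      []            = 0 , λ m → [] , refl
  -- The witness is chosen so that its successor reduces to `suc d * suc D`.
  clear-denominators (y ∷ a) (0≤y ∷ 0≤a) = D ℕ.+ d ℕ.* suc D , scale
    where
    cleared = clear-denominator y 0≤y
    d = proj₁ cleared
    n = proj₁ (proj₂ cleared)
    rec = clear-denominators a 0≤a
    D = proj₁ rec
    scale : ∀ m → ∃ λ s → Vec.map ℕtoℚ s ≡ Vec.map (ℕtoℚ (m ℕ.* (suc d ℕ.* suc D)) *_) (y ∷ a)
    scale m = m ℕ.* suc D ℕ.* n ∷ proj₁ (proj₂ rec (m ℕ.* suc d)) ,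
      cong₂ _∷_ first (trans (proj₂ (proj₂ rec (m ℕ.* suc d)))
        (cong (λ t → Vec.map (ℕtoℚ t *_) a) (ℕ.*-assoc m (suc d) (suc D))))
      where
      open ≡-Reasoning
      regroup : ∀ m d D → m ℕ.* (d ℕ.* D) ≡ m ℕ.* D ℕ.* d
      regroup = ℕRing.solve-∀
      first : ℕtoℚ (m ℕ.* suc D ℕ.* n) ≡ ℕtoℚ (m ℕ.* (suc d ℕ.* suc D)) * y
      first = begin
        ℕtoℚ (m ℕ.* suc D ℕ.* n)                        ≡⟨ ℕtoℚ-* (m ℕ.* suc D) n ⟩
        ℕtoℚ (m ℕ.* suc D) * ℕtoℚ n                     ≡⟨ cong (ℕtoℚ (m ℕ.* suc D) *_) (proj₂ (proj₂ cleared)) ⟨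
        ℕtoℚ (m ℕ.* suc D) * (ℕtoℚ (suc d) * y)         ≡⟨ *-assoc (ℕtoℚ (m ℕ.* suc D)) (ℕtoℚ (suc d)) y ⟨
        ℕtoℚ (m ℕ.* suc D) * ℕtoℚ (suc d) * y           ≡⟨ cong (_* y) (ℕtoℚ-* (m ℕ.* suc D) (suc d)) ⟨
        ℕtoℚ (m ℕ.* suc D ℕ.* suc d) * y                ≡⟨ cong (λ t → ℕtoℚ t * y) (regroup m (suc d) (suc D)) ⟨
        ℕtoℚ (m ℕ.* (suc d ℕ.* suc D)) * y              ∎

  -- Homogeneity of the elementary symmetric polynomial of degree `j` under scaling by `c`.
  ℕtoℚ-esym : ∀ {k} c (s : Vec ℕ k) (a : Vec ℚ k) → Vec.map ℕtoℚ s ≡ Vec.map (c *_) a →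
    ∀ j → ℕtoℚ (esym s j) ≡ c ^ℚ j * esymℚ a j
  ℕtoℚ-esym c s       a       e zero    = refl
  ℕtoℚ-esym c []      []      e (suc j) = sym (*-zeroʳ (c ^ℚ suc j))
  ℕtoℚ-esym c (x ∷ s) (y ∷ a) e (suc j) = begin
    ℕtoℚ (esym s (suc j) ℕ.+ x ℕ.* esym s j)
      ≡⟨ ℕtoℚ-+ (esym s (suc j)) (x ℕ.* esym s j) ⟩
    ℕtoℚ (esym s (suc j)) + ℕtoℚ (x ℕ.* esym s j)
      ≡⟨ cong (λ t → ℕtoℚ (esym s (suc j)) + t) (ℕtoℚ-* x (esym s j)) ⟩
    ℕtoℚ (esym s (suc j)) + ℕtoℚ x * ℕtoℚ (esym s j)
      ≡⟨ cong₂ _+_ (ℕtoℚ-esym c s a (proj₂ (∷-injective e)) (suc j))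
                   (cong₂ _*_ (proj₁ (∷-injective e)) (ℕtoℚ-esym c s a (proj₂ (∷-injective e)) j)) ⟩
    c * c ^ℚ j * esymℚ a (suc j) + c * y * (c ^ℚ j * esymℚ a j)
      ≡⟨ identity c y (c ^ℚ j) (esymℚ a (suc j)) (esymℚ a j) ⟩
    c * c ^ℚ j * (esymℚ a (suc j) + y * esymℚ a j) ∎
    where
    open ≡-Reasoning
    identity : ∀ c y r p q → c * r * p + c * y * (r * q) ≡ c * r * (p + y * q)
    identity = solve-∀ ring

  esym-1 : ∀ {k} (s : Vec ℕ k) → esym s 1 ≡ Vec.sum s
  esym-1 []      = refl
  esym-1 (a ∷ s) = trans (cong₂ ℕ._+_ (esym-1 s) (ℕ.*-identityʳ a)) (ℕ.+-comm (Vec.sum s) a)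

  -- The factor `j !` appears in the error because the clique count is `j !` times an elementary
  -- symmetric polynomial, and the factorisation controls the latter within `ε`.
  CliqueDensities : ℕ → ℚ → ℚ → ∀ {n} → Graph n → Set
  CliqueDensities k q ε {n} G = ∀ j → j ℕ.≤ k →
    ∣ ℕtoℚ (copies (K j) G) - q ^ℚ choose2 j * ℕtoℚ (n ℕ.^ j) ∣ ≤ ℕtoℚ (j !) * ε * ℕtoℚ (n ℕ.^ j)

  module _ (k : ℕ) {q ε : ℚ} (0<q : 0ℚ < q) (q≤¼ : q ≤ (+ 1) / 4) (0<ε : 0ℚ < ε) (N : ℕ) where

    private
      ρ = ratio q
      e = coefficient 0<q q≤¼
      points : ℕ → ℚ
      points j = ½ * ρ j
      0<points : ∀ j → 0ℚ < points j
      0<points j = 0<* 0<½ (0<ratio 0<q q≤¼ j)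
      points-decreasing : ∀ j → points (suc j) < points j
      points-decreasing j =
        *-monoʳ-<-pos ½ (ρ-decreasing ρ (0<ratio 0<q q≤¼) (4ratio<ratio 0<q q≤¼) j)
      factorisation = approximate-factorisation k e points refl 0<points points-decreasing
        (partial-product-alternating ρ (0<ratio 0<q q≤¼) (4ratio<ratio 0<q q≤¼) (suc k)) 0<ε
      a = proj₁ factorisation
      cleared = clear-denominators a (proj₁ (proj₂ (proj₂ factorisation)))
      c = suc N ℕ.* suc (proj₁ cleared)
      s = proj₁ (proj₂ cleared (suc N))
      s≡ca = proj₂ (proj₂ cleared (suc N))
      n = Vec.sum s

      -- The coefficient `e 1` reduces to 1, and the factorisation is exact in degree 1, so the
      -- scaled parts add up to the scale `c` itself.
      n≡c : ℕtoℚ n ≡ ℕtoℚ c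
      n≡c = begin
        ℕtoℚ n                  ≡⟨ cong ℕtoℚ (esym-1 s) ⟨
        ℕtoℚ (esym s 1)         ≡⟨ ℕtoℚ-esym (ℕtoℚ c) s a s≡ca 1 ⟩
        ℕtoℚ c ^ℚ 1 * esymℚ a 1 ≡⟨ cong (ℕtoℚ c ^ℚ 1 *_) (proj₁ (proj₂ (proj₂ (proj₂ factorisation)))) ⟩
        ℕtoℚ c ^ℚ 1 * 1ℚ        ≡⟨ identity (ℕtoℚ c) ⟩
        ℕtoℚ c                  ∎
        where
        open ≡-Reasoning
        identity : ∀ c → c * 1ℚ * 1ℚ ≡ c
        identity = solve-∀ ring

      densities : CliqueDensities (suc k) q ε (multipartite (blocks s))
      densities j j≤k = begin
        ∣ ℕtoℚ (copies (K j) (multipartite (blocks s))) - q ^ℚ choose2 j * W ∣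
          ≡⟨ cong₂ (λ x y → ∣ x - y * W ∣) count (sym (!*coefficient 0<q q≤¼ j)) ⟩
        ∣ f * (W * esymℚ a j) - f * e j * W ∣
          ≡⟨ cong ∣_∣ (identity f W (esymℚ a j) (e j)) ⟩
        ∣ f * W * (esymℚ a j - e j) ∣
          ≤⟨ ∣p*q∣≤ (≤-reflexive (0≤p⇒∣p∣≡p (0≤* (0≤ℕtoℚ (j !)) (0≤ℕtoℚ (n ℕ.^ j)))))
                    (proj₂ (proj₂ (proj₂ (proj₂ factorisation))) j j≤k) ⟩
        f * W * ε
          ≡⟨ regroup f W ε ⟩
        f * ε * W ∎
        where
        open ≤-Reasoning
        f = ℕtoℚ (j !)
        W = ℕtoℚ (n ℕ.^ j)
        count : ℕtoℚ (copies (K j) (multipartite (blocks s))) ≡ f * (W * esymℚ a j)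
        count = trans (cong ℕtoℚ (multipartite-cliques s j)) (trans (ℕtoℚ-* (j !) (esym s j))
          (cong (f *_) (trans (ℕtoℚ-esym (ℕtoℚ c) s a s≡ca j)
            (cong (_* esymℚ a j) (trans (cong (_^ℚ j) (sym n≡c)) (sym (ℕtoℚ-^ n j)))))))
        identity : ∀ f w x y → f * (w * x) - f * y * w ≡ f * w * (x - y)
        identity = solve-∀ ring
        regroup : ∀ f w e → f * w * e ≡ f * e * w
        regroup = solve-∀ ring

      large : N ℕ.≤ n
      large = ℕtoℚ-cancel (≤-trans
        (ℕtoℚ-mono (ℕ.≤-trans (ℕ.n≤1+n N) (ℕ.m≤m*n (suc N) (suc (proj₁ cleared)))))
        (≤-reflexive (sym n≡c)))

      half-head : ∀ {k} (s : Vec ℕ (suc k)) (a : Vec ℚ (suc k)) → Vec.map ℕtoℚ s ≡ Vec.map (ℕtoℚ c *_) a →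
        ½ ≤ head a → ℕtoℚ c ≤ ℕtoℚ (2 ℕ.* size (Vec.map isZero (blocks s)))
      half-head (x ∷ s) (y ∷ a) s≡ca ½≤y = begin
        ℕtoℚ c                      ≡⟨ identity (ℕtoℚ c) ⟩
        2ℚ * (ℕtoℚ c * ½)           ≤⟨ *-monoˡ (<⇒≤ (positive⁻¹ 2ℚ)) (*-monoˡ (0≤ℕtoℚ c) ½≤y) ⟩
        2ℚ * (ℕtoℚ c * y)           ≡⟨ cong (2ℚ *_) (proj₁ (∷-injective s≡ca)) ⟨
        2ℚ * ℕtoℚ x                 ≡⟨ ℕtoℚ-* 2 x ⟨
        ℕtoℚ (2 ℕ.* x)              ≤⟨ ℕtoℚ-mono (ℕ.*-monoʳ-≤ 2 (firstBlock-size x s)) ⟩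
        ℕtoℚ (2 ℕ.* size (Vec.map isZero (blocks (x ∷ s)))) ∎
        where
        open ≤-Reasoning
        identity : ∀ c → c ≡ 2ℚ * (c * ½)
        identity = solve-∀ ring

    clique-graph : ∃ λ n → Σ (Graph n) λ G → N ℕ.≤ n × CliqueDensities (suc k) q ε G ×
      Σ (Subset n) λ S → Independent G S × n ℕ.≤ 2 ℕ.* size S
    clique-graph = n , multipartite (blocks s) , large , densities ,
      Vec.map isZero (blocks s) , multipartite-independent (blocks s) ,
      -- The first root exceeds `points 1`, which reduces to `½` because `ρ 1` is 1.
      ℕtoℚ-cancel (≤-trans (≤-reflexive n≡c) (half-head s a s≡ca (<⇒≤ (proj₁ (proj₂ factorisation)))))

  -- From absolute errors at rational densities to relative estimates at the real `p`.

  upper-estimate : ∀ {X Q R W ε μ} → 0ℚ ≤ W → 0ℚ ≤ ε → X - Q * W ≤ μ * W → μ ≤ ε * Q → Q ≤ R →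
    X ≤ (1ℚ + ε) * R * W
  upper-estimate {X} {Q} {R} {W} {ε} {μ} 0≤W 0≤ε X≤ μ≤εQ Q≤R = ≤-by
    ((μ * W - (X - Q * W)) + (ε * Q - μ) * W + (1ℚ + ε) * (R - Q) * W)
    (0≤+ (0≤+ (p≤q⇒0≤q-p X≤) (0≤* (p≤q⇒0≤q-p μ≤εQ) 0≤W))
         (0≤* (0≤* (0≤+ (<⇒≤ 0<1) 0≤ε) (p≤q⇒0≤q-p Q≤R)) 0≤W))
    (identity X Q R W ε μ)
    where
    identity : ∀ X Q R W ε μ → (1ℚ + ε) * R * W ≡
      X + ((μ * W - (X - Q * W)) + (ε * Q - μ) * W + (1ℚ + ε) * (R - Q) * W)
    identity = solve-∀ ring

  -- For `ε ≤ 1`, `(1 - ε) R` is at most `(1 - ε)(Q + ν)`, and the budget `μ + ν ≤ ε Q` brings this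
  -- down to `Q - μ`. For `ε ≥ 1` the left side is not positive.
  lower-estimate : ∀ {X Q R W ε μ ν} → 0ℚ ≤ X → 0ℚ ≤ R → 0ℚ ≤ W → 0ℚ ≤ ε → 0ℚ ≤ ν →
    Q * W - X ≤ μ * W → μ + ν ≤ ε * Q → R ≤ Q + ν → (1ℚ - ε) * R * W ≤ X
  lower-estimate {X} {Q} {R} {W} {ε} {μ} {ν} 0≤X 0≤R 0≤W 0≤ε 0≤ν X≥ μ+ν≤εQ R≤Q+ν = by-cases (≤-total ε 1ℚ)
    where
    identity₁ : ∀ X Q R W ε μ ν → X ≡ (1ℚ - ε) * R * W +
      ((μ * W - (Q * W - X)) + ((1ℚ - ε) * (Q + ν - R) + (ε * Q - (μ + ν)) + ε * ν) * W)
    identity₁ = solve-∀ ring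
    identity₂ : ∀ X R W ε → X ≡ (1ℚ - ε) * R * W + (X + (ε - 1ℚ) * R * W)
    identity₂ = solve-∀ ring
    by-cases : ε ≤ 1ℚ ⊎ 1ℚ ≤ ε → (1ℚ - ε) * R * W ≤ X
    by-cases (inj₁ ε≤1) = ≤-by
      ((μ * W - (Q * W - X)) + ((1ℚ - ε) * (Q + ν - R) + (ε * Q - (μ + ν)) + ε * ν) * W)
      (0≤+ (p≤q⇒0≤q-p X≥)
           (0≤* (0≤+ (0≤+ (0≤* (p≤q⇒0≤q-p ε≤1) (p≤q⇒0≤q-p R≤Q+ν)) (p≤q⇒0≤q-p μ+ν≤εQ)) (0≤* 0≤ε 0≤ν)) 0≤W))
      (identity₁ X Q R W ε μ ν)
    by-cases (inj₂ 1≤ε) = ≤-by (X + (ε - 1ℚ) * R * W)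
      (0≤+ 0≤X (0≤* (0≤* (p≤q⇒0≤q-p 1≤ε) 0≤R) 0≤W)) (identity₂ X R W ε)

  seq-bound : ∀ (p : ℝ) i l → seq p i - inv i ≤ seq p l + inv l
  seq-bound p i l = ≤-by ((inv i + inv l) - (seq p i - seq p l))
    (p≤q⇒0≤q-p (≤-trans (p≤∣p∣ _) (reg p i l))) (identity (seq p i) (seq p l) (inv i) (inv l))
    where
    identity : ∀ x y a b → y + b ≡ x - a + ((a + b) - (x - y))
    identity = solve-∀ ring

  module Approximation (p : ℝ) (0<p : 0ℚ <ʳ p) (p≤¼ : p ʳ≤ ((+ 1) / 4)) where

    private
      i₀ = proj₁ 0<p
      g = seq p i₀ - inv i₀
      0<g : 0ℚ < g
      0<g = p<q⇒0<q-p (subst (_< seq p i₀) (+-identityˡ (inv i₀)) (proj₂ 0<p))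
      0<½g = 0<* 0<½ 0<g
      eventually-≤½g = inv-small 2ℚ 0<½g
      M = proj₁ eventually-≤½g
      fine : ∀ m → ∃ λ M → ∀ i → M ℕ.≤ i → 2ℚ * inv i ≤ inv m
      fine m = inv-small 2ℚ (0<inv m)
      index : ℕ → ℕ
      index m = M ℕ.+ proj₁ (fine m)

    -- A Cauchy term minus its own error bound never exceeds `p`, and `p ʳ≤ ¼` bounds exactly this
    -- expression. The index is large enough that `q m` stays above `q₀` and within `inv m` of `p`.
    q : ℕ → ℚ
    q m = seq p (index m) - inv (index m)

    -- A positive lower bound common to all `q m`; without it the permitted error `ε * q m ^ℚ C`
    -- might shrink with `m`.
    q₀ : ℚ
    q₀ = ½ * g

    0<q₀ : 0ℚ < q₀
    0<q₀ = 0<½g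

    q₀≤q : ∀ m → q₀ ≤ q m
    q₀≤q m = ≤-by ((½ * g - 2ℚ * inv i) + (seq p i + inv i - g))
      (0≤+ (p≤q⇒0≤q-p (proj₂ eventually-≤½g i (ℕ.m≤m+n M _))) (p≤q⇒0≤q-p (seq-bound p i₀ i)))
      (identity (seq p i) (inv i) g)
      where
      i = index m
      identity : ∀ x a g → x - a ≡ ½ * g + ((½ * g - 2ℚ * a) + (x + a - g))
      identity = solve-∀ ring

    0<q : ∀ m → 0ℚ < q m
    0<q m = <-≤-trans 0<q₀ (q₀≤q m)

    q≤¼ : ∀ m → q m ≤ (+ 1) / 4
    q≤¼ m = p≤¼ (index m)

    q≤ : ∀ m {r} → p ʳ< r → q m ≤ r
    q≤ m (l , x+a<r) = ≤-trans (seq-bound p (index m) l) (<⇒≤ x+a<r)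

    ≤q+inv : ∀ m {r} → r <ʳ p → r ≤ q m + inv m
    ≤q+inv m {r} (l , r+a<x) = ≤-by
      ((inv m - 2ℚ * inv i) + (seq p i + inv i - (seq p l - inv l)) + (seq p l - (r + inv l)))
      (0≤+ (0≤+ (p≤q⇒0≤q-p (proj₂ (fine m) i (ℕ.m≤n+m (proj₁ (fine m)) M))) (p≤q⇒0≤q-p (seq-bound p l i)))
           (p≤q⇒0≤q-p (<⇒≤ r+a<x)))
      (identity (seq p i) (inv i) (seq p l) (inv l) (inv m) r)
      where
      i = index m
      identity : ∀ x a y b c r → x - a + c ≡ r + ((c - 2ℚ * a) + (x + a - (y - b)) + (y - (r + b)))
      identity = solve-∀ ring

    <p⇒≤1 : ∀ {r} → r <ʳ p → r ≤ 1ℚ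
    <p⇒≤1 {r} (l , r+a<x) = ≤-trans (≤-trans
      (≤-by (seq p l - (r + inv l)) (p≤q⇒0≤q-p (<⇒≤ r+a<x)) (identity (seq p l) (inv l) r))
      (p≤¼ l)) (≤-by ((+ 3) / 4) (nonNegative⁻¹ ((+ 3) / 4)) refl)
      where
      identity : ∀ y b r → y - b ≡ r + (y - (r + b))
      identity = solve-∀ ring

    clique-estimates : ∀ {k} (n : ℕ → ℕ) (G : ∀ m → Graph (n m)) →
      (∀ m → CliqueDensities k (q m) (inv m) (G m)) →
      ∀ j → j ℕ.≤ k → ∀ ε → 0ℚ < ε → ∃ λ M → ∀ m → M ℕ.≤ m →
        (∀ r → 0ℚ < r → r <ʳ p →
          (1ℚ - ε) * (r ^ℚ choose2 j) * ℕtoℚ (n m ℕ.^ j) ≤ ℕtoℚ (copies (K j) (G m)))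
        × (∀ r → p ʳ< r →
          ℕtoℚ (copies (K j) (G m)) ≤ (1ℚ + ε) * (r ^ℚ choose2 j) * ℕtoℚ (n m ℕ.^ j))
    clique-estimates n G densities j j≤k ε 0<ε = proj₁ small , λ m M≤m → lower m M≤m , upper m M≤m
      where
      C = choose2 j
      -- The term `j !` pays for the density error and `C` for passing from `q m` to `r` by
      -- `^-lipschitz`. Measuring against `q₀` makes the threshold independent of `r`.
      small = inv-small (ℕtoℚ (j !) + ℕtoℚ C) (0<* 0<ε (0<^ 0<q₀ C))
      0≤ε = <⇒≤ 0<ε
      errors≤ : ∀ m → proj₁ small ℕ.≤ m → ℕtoℚ (j !) * inv m + ℕtoℚ C * inv m ≤ ε * q m ^ℚ C
      errors≤ m M≤m = ≤-trans (≤-reflexive (sym (*-distribʳ-+ (inv m) (ℕtoℚ (j !)) (ℕtoℚ C))))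
        (≤-trans (proj₂ small m M≤m) (*-monoˡ 0≤ε (proj₂ (^-mono (<⇒≤ 0<q₀) (q₀≤q m) C))))
      0≤C*inv : ∀ m → 0ℚ ≤ ℕtoℚ C * inv m
      0≤C*inv m = 0≤* (0≤ℕtoℚ C) (<⇒≤ (0<inv m))
      lower : ∀ m → proj₁ small ℕ.≤ m → ∀ r → 0ℚ < r → r <ʳ p →
        (1ℚ - ε) * (r ^ℚ C) * ℕtoℚ (n m ℕ.^ j) ≤ ℕtoℚ (copies (K j) (G m))
      lower m M≤m r 0<r r<p = lower-estimate {μ = ℕtoℚ (j !) * inv m}
        (0≤ℕtoℚ (copies (K j) (G m))) (<⇒≤ (0<^ 0<r C)) (0≤ℕtoℚ (n m ℕ.^ j)) 0≤ε (0≤C*inv m)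
        (≤-trans (≤-reflexive (flip (ℕtoℚ (copies (K j) (G m))) (q m ^ℚ C * ℕtoℚ (n m ℕ.^ j))))
          (≤-trans (-p≤∣p∣ _) (densities m j j≤k)))
        (errors≤ m M≤m)
        (^-lipschitz (<⇒≤ (0<q m)) (≤-trans (q≤¼ m) (≤-by ((+ 3) / 4) (nonNegative⁻¹ ((+ 3) / 4)) refl))
          (<⇒≤ 0<r) (<p⇒≤1 r<p) (<⇒≤ (0<inv m)) (≤q+inv m r<p) C)
        where
        flip : ∀ x y → y - x ≡ - (x - y)
        flip = solve-∀ ring
      upper : ∀ m → proj₁ small ℕ.≤ m → ∀ r → p ʳ< r →
        ℕtoℚ (copies (K j) (G m)) ≤ (1ℚ + ε) * (r ^ℚ C) * ℕtoℚ (n m ℕ.^ j)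
      upper m M≤m r p<r = upper-estimate {μ = ℕtoℚ (j !) * inv m} (0≤ℕtoℚ (n m ℕ.^ j)) 0≤ε
        (≤-trans (p≤∣p∣ _) (densities m j j≤k))
        (≤-trans (≤-by (ℕtoℚ C * inv m) (0≤C*inv m) refl) (errors≤ m M≤m))
        (proj₂ (^-mono (<⇒≤ (0<q m)) (q≤ m p<r) C))

open import Data.Nat using (ℕ; _≤_; _*_; _^_)
open import Data.Rational using (ℚ; _<_; 0ℚ; 1ℚ) renaming (_≤_ to _≤ℚ_; _+_ to _+ℚ_; _-_ to _-ℚ_; _*_ to _*ℚ_; _/_ to _/ℚ_)
open import Data.Integer using (+_)
open import Data.Nat using (suc)
open import Data.Nat.Properties using (≤-trans)
open OrderedFieldℚ using (0<inv)
open Construction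

theorem2 : (k : ℕ) → 2 ≤ k →
    (p : ℝ) → 0ℚ <ʳ p → p ʳ≤ ((+ 1) /ℚ 4) →
    Σ (ℕ → ℕ) λ n → Σ ((m : ℕ) → Graph (n m)) λ G →
    (∀ N → ∃ λ M → ∀ m → M ≤ m → N ≤ n m)
    × (∀ j → 2 ≤ j → j ≤ k → (ε : ℚ) → 0ℚ < ε →
    ∃ λ M → ∀ m → M ≤ m →
    (∀ r → 0ℚ < r → r <ʳ p →
    ((1ℚ -ℚ ε) *ℚ (r ^ℚ choose2 j)) *ℚ ℕtoℚ (n m ^ j) ≤ℚ ℕtoℚ (copies (K j) (G m)))
    × (∀ r → p ʳ< r →
    ℕtoℚ (copies (K j) (G m)) ≤ℚ ((1ℚ +ℚ ε) *ℚ (r ^ℚ choose2 j)) *ℚ ℕtoℚ (n m ^ j)))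
    × (∀ m → Σ (Subset (n m)) λ S → Independent (G m) S × n m ≤ 2 * size S)
theorem2 (suc k) _ p 0<p p≤¼ =
  n , G ,
  (λ N → N , λ m N≤m → ≤-trans N≤m (proj₁ (proj₂ (proj₂ (graph m))))) ,
  (λ j _ j≤k → clique-estimates n G (λ m → proj₁ (proj₂ (proj₂ (proj₂ (graph m))))) j j≤k) ,
  (λ m → proj₂ (proj₂ (proj₂ (proj₂ (graph m)))))
  where
  open Approximation p 0<p p≤¼
  graph : ∀ m → ∃ λ n → Σ (Graph n) λ G → m ≤ n × CliqueDensities (suc k) (q m) (inv m) G ×
    Σ (Subset n) λ S → Independent G S × n ≤ 2 * size S
  -- Stage `m` uses density `q m`, tolerance `inv m` and at least `m` vertices, so one index drives
  -- all three limits.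
  graph m = clique-graph k (0<q m) (q≤¼ m) (0<inv m) m
  n : ℕ → ℕ
  n m = proj₁ (graph m)
  G : ∀ m → Graph (n m)
  G m = proj₁ (proj₂ (graph m))
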